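{- Let $\rho$ be the evaluation of palindromic polynomials defined in the context, and put $A_k=\rho(x^k)$, $B_k=\rho\bigl((1+x)x^k\bigr)$ for $k\ge0$. Let $a=(a_m)_{m\ge0}$ be the sequence interleaving $A$ and $B$, namely $a_{2k}=A_k$ and $a_{2k+1}=B_k$. For $N\ge1$ let $M_N$ be the $N\times N$ matrix with entries $M_N(i,j)=\rho\bigl(x^i(1+x)^j\bigr)\,2^{ -\lfloor j/2\rfloor}$, $0\le i,j\le N-1$. Then $$\det M_N=2^{\tau_N}\,\det\bigl(a_{2i+j}\bigr)_{0\le i,j\le N-1}, \qquad \tau_N=\binom{\lceil N/2\rceil}{2}+\binom{\lfloor N/2\rfloor}{2}.$$
   Context: The index of a nonzero polynomial is its degree plus its valuation (the order of vanishing at $0$). A polynomial $P\in\mathbb Q[x]$ is palindromic of index $d$ if $x^dP(1/x)=P(x)$; e.g. $x^i(1+x)^j$ is palindromic of index $2i+j$. For $P$ palindromic of index $d$ put $$\mathscr N_0(P)=\frac{(x^{d}+1)\,P(1)-2P(x)}{(x-1)^2},$$ which is a polynomial, palindromic of index $d-2$ when nonzero (and $\mathscr N_0(0)=0$). Define $\rho(P)$ to be the constant term of $\mathscr N_0^{\lfloor d/2\rfloor}(P)$ (at each iteration $\mathscr N_0$ is formed with the current index); in particular $\rho(1)=1$ and $\rho(c(1+x))=c$. -}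

module Defs where

open import Algebra.Definitions.RawSemiring using (sum)
open import Data.Bool.Base using (if_then_else_)
open import Data.Fin.Base using (Fin; zero; suc; toℕ; punchIn)
open import Data.Integer.Base using (+_)
open import Data.List.Base using (List; []; _∷_; map; foldr)
open import Data.Maybe.Base as Maybe using (Maybe; just; nothing)
open import Data.Nat.Base as ℕ using (ℕ; zero; suc; ⌊_/2⌋; ⌈_/2⌉)
open import Data.Nat.Combinatorics using (_C_)
open import Data.Nat.GeneralisedArithmetic using (iterate)
open import Data.Rational.Base
  using (ℚ; 0ℚ; 1ℚ; _+_; _*_; -_; _/_; +-*-rawSemiring)
open import Data.Rational.Properties using (_≟_)
open import Function.Base using (_∘_)
open import Relation.Nullary.Decidable.Core using (does)

open import Algebra.Definitions.RawSemiring +-*-rawSemiring public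
  using (_^_)

2ℚ : ℚ
2ℚ = + 2 / 1

-- A polynomial over ℚ is its list of coefficients, constant term first.
-- Trailing zeros are allowed: lists differing only in them represent the
-- same polynomial, and every operation below respects this.

Poly : Set
Poly = List ℚ

infixl 6 _⊕_
infixl 7 _⊗_ _·_
infixr 8 _^ₚ_
infixl 9 _/[x-1]

constantTerm : Poly → ℚ
constantTerm []      = 0ℚ
constantTerm (c ∷ _) = c

_⊕_ : Poly → Poly → Poly
[]      ⊕ q       = q
(a ∷ p) ⊕ []      = a ∷ p
(a ∷ p) ⊕ (b ∷ q) = (a + b) ∷ (p ⊕ q)

_·_ : ℚ → Poly → Poly
c · p = map (c *_) p

_⊗_ : Poly → Poly → Poly
[]      ⊗ q = []
(a ∷ p) ⊗ q = a · q ⊕ (0ℚ ∷ p ⊗ q)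

1ₚ : Poly
1ₚ = 1ℚ ∷ []

X : Poly
X = 0ℚ ∷ 1ℚ ∷ []

_^ₚ_ : Poly → ℕ → Poly
p ^ₚ zero  = 1ₚ
p ^ₚ suc n = p ⊗ p ^ₚ n

eval : Poly → ℚ → ℚ
eval p t = foldr (λ c r → c + t * r) 0ℚ p

-- The degree, the valuation and the index are `nothing` exactly for the
-- zero polynomial.

degree : Poly → Maybe ℕ
degree []      = nothing
degree (c ∷ p) with degree p
... | just n  = just (suc n)
... | nothing = if does (c ≟ 0ℚ) then nothing else just 0

valuation : Poly → Maybe ℕ
valuation []      = nothing
valuation (c ∷ p) =
  if does (c ≟ 0ℚ) then Maybe.map suc (valuation p) else just 0

index : Poly → Maybe ℕ
index p = Maybe.zipWith ℕ._+_ (degree p) (valuation p)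

-- The quotient of the division by x - 1: if p = (x - 1) q + p(1), then
-- c + x p = (x - 1) (p(1) + x q) + (c + p(1)).

_/[x-1] : Poly → Poly
[] /[x-1]      = []
(c ∷ p) /[x-1] = eval p 1ℚ ∷ p /[x-1]

-- N₀ and ρ are total, but are meaningful only on palindromic polynomials.
-- If x^d p(1/x) = p(x) with d the index of p, then (x^d + 1) p(1) - 2 p vanishes to
-- order at least two at 1, so both divisions below leave no remainder.

N₀ : Poly → Poly
N₀ p with index p
... | nothing = []
... | just d  =
  (eval p 1ℚ · (X ^ₚ d ⊕ 1ₚ) ⊕ (- 2ℚ) · p) /[x-1] /[x-1]

-- The value at the zero polynomial, which has no index, is set to 0.

ρ : Poly → ℚ
ρ p with index p
... | nothing = 0ℚ
... | just d  = constantTerm (iterate N₀ p ⌊ d /2⌋)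

1+X : Poly
1+X = 1ₚ ⊕ X

A B : ℕ → ℚ
A k = ρ (X ^ₚ k)
B k = ρ (1+X ⊗ X ^ₚ k)

-- f 0, g 0, f 1, g 1, f 2, …

interleave : (ℕ → ℚ) → (ℕ → ℚ) → ℕ → ℚ
interleave f g zero    = f zero
interleave f g (suc m) = interleave g (f ∘ suc) m

a : ℕ → ℚ
a = interleave A B

Matrix : ℕ → Set
Matrix n = Fin n → Fin n → ℚ

-- Laplace expansion along the first row.

det : ∀ {n} → Matrix n → ℚ
det {zero}  m = 1ℚ
det {suc n} m = sum +-*-rawSemiring λ j →
  (- 1ℚ) ^ toℕ j * m zero j * det (λ i k → m (suc i) (punchIn j k))

-- The factor 2^(-⌊j/2⌋) is written as a power of 1/2.

M : ∀ N → Matrix N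
M N i j = ρ (X ^ₚ toℕ i ⊗ 1+X ^ₚ toℕ j) * (+ 1 / 2) ^ ⌊ toℕ j /2⌋

τ : ℕ → ℕ
τ N = (⌈ N /2⌉ C 2) ℕ.+ (⌊ N /2⌋ C 2)

{-# OPTIONS --safe #-}
-- Since (1 + x)² = (x - 1)² + 4x and N₀ sends (x - 1)² Q to -2 Q, the entries of M
-- satisfy M(i, j + 2) = 2 M(i + 1, j) - M(i, j).  With H(i, j) = a(2i + j), which
-- satisfies H(i + 1, j) = H(i, j + 2) and agrees with M in the columns 0 and 1, it
-- follows that column j of M is 2^⌊j/2⌋ times column j of H plus a combination of
-- earlier columns of H.  The determinants therefore differ by the factor
-- 2^(Σ_{j<N} ⌊j/2⌋) = 2^τ(N).
module Submission where

open import Defs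
open import Algebra.Bundles using (CommutativeRing)
open import Data.Fin.Base using (toℕ)
open import Data.Fin.Base using (Fin; zero; suc; punchIn)
open import Data.Fin.Properties using (toℕ<n)
open import Data.List.Base using ([]; _∷_)
open import Data.Maybe.Base using (Maybe; just; nothing)
open import Data.Nat.Base using (ℕ; _≤_; _+_; _*_)
open import Data.Nat.Base
  using (zero; suc; _<_; _∸_; z≤n; s≤s; z<s; s<s; s≤s⁻¹; ⌊_/2⌋; ⌈_/2⌉)
open import Data.Nat.Combinatorics using (_C_; nC1≡n; nCk+nC[k+1]≡[n+1]C[k+1])
open import Data.Nat.GeneralisedArithmetic using (iterate)
import Data.Nat.Properties as ℕₚ
open import Data.Product.Base using (∃; _×_; _,_)
import Data.Rational.Base as ℚ
open ℚ using (ℚ; 0ℚ; 1ℚ; ½)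
import Data.Rational.Properties as ℚₚ
open import Data.Rational.Solver using (module +-*-Solver)
open import Data.Sum.Base using (_⊎_; inj₁; inj₂)
open import Function.Base using (_∘_)
open import Relation.Binary.PropositionalEquality using (_≡_)
open import Relation.Binary.PropositionalEquality
  using (_≢_; _≗_; refl; sym; trans; cong; cong₂; cong-app; subst; ≢-sym; module ≡-Reasoning)
open import Relation.Nullary using (yes; no; contradiction)

open import Algebra.Properties.Semiring.Exp (CommutativeRing.semiring ℚₚ.+-*-commutativeRing)
  using (^-homo-*)
open import Algebra.Properties.Semiring.Sum (CommutativeRing.semiring ℚₚ.+-*-commutativeRing)
  using (sum; sum-cong-≗; *-distribˡ-sum)

open +-*-Solver using (solve; _:=_; _:+_; _:*_; _:-_; :-_; con)
open ≡-Reasoning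

-- Determinants

-- The evaluation `ρ` is not visibly linear: the index is read off from each polynomial, and the
-- zero polynomial has none. Hence `ρᵈ`, where the index `d` is prescribed and linearity holds for
-- all lists. It agrees with `ρ` on every list that is palindromic of index `d`, since such a list
-- has index `d` unless it represents zero, where both values are 0. The identity for (1 + x)² can
-- be used under `ρᵈ` because, once multiplied by x^i (1 + x)^j, its three terms are all palindromic
-- for the same index 2i + j + 2. The recurrence in the overview reads row i + 1, which leaves the N
-- × N square at its last row. The column relations are therefore proved for infinite columns and
-- cut down only inside the determinant. Since `det` is an expansion along the first row, the effect
-- of column operations has to be derived from that expansion.

det-cong : ∀ {n} {m m′ : Matrix n} → (∀ i j → m i j ≡ m′ i j) → det m ≡ det m′
det-cong {zero}  eq = refl
det-cong {suc n} eq = sum-cong-≗ λ j →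
  cong₂ (λ x y → (ℚ.- 1ℚ) ^ toℕ j ℚ.* x ℚ.* y) (eq zero j)
    (det-cong λ i k → eq (suc i) (punchIn j k))

-- Columns c j are indexed by all of ℕ; D n c only reads the first n entries of the first n.
Columns : Set
Columns = ℕ → ℕ → ℚ

D : ℕ → Columns → ℚ
D n c = det {n} λ i j → c (toℕ j) (toℕ i)

D-cong : ∀ n {c c′} → (∀ j → j < n → c j ≗ c′ j) → D n c ≡ D n c′
D-cong n eq = det-cong {n} λ i j → eq (toℕ j) (toℕ<n j) (toℕ i)

-- `punchIn` without bounds, so that minors of infinite families of columns are again such families.
skip : ℕ → ℕ → ℕ
skip zero    k       = suc k
skip (suc j) zero    = zero
skip (suc j) (suc k) = suc (skip j k)

toℕ-punchIn : ∀ {n} (j : Fin (suc n)) k → toℕ (punchIn j k) ≡ skip (toℕ j) (toℕ k)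
toℕ-punchIn zero    k       = refl
toℕ-punchIn (suc j) zero    = refl
toℕ-punchIn (suc j) (suc k) = cong suc (toℕ-punchIn j k)

skip-≢ : ∀ j k → skip j k ≢ j
skip-≢ (suc j) (suc k) eq = skip-≢ j k (ℕₚ.suc-injective eq)

skip-injective : ∀ j {k l} → skip j k ≡ skip j l → k ≡ l
skip-injective zero    eq = ℕₚ.suc-injective eq
skip-injective (suc j) {zero}  {zero}  eq = refl
skip-injective (suc j) {suc k} {suc l} eq =
  cong suc (skip-injective j (ℕₚ.suc-injective eq))

skip-surjective : ∀ {n} j p → j < suc n → p < suc n → j ≢ p →
  ∃ λ q → q < n × skip j q ≡ p
skip-surjective zero    zero    _ _ j≢p = contradiction refl j≢p
skip-surjective zero    (suc p) _ (s<s p<n) _ = p , p<n , refl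
skip-surjective (suc j) zero    (s<s j<n) _ _ = zero , ℕₚ.≤-<-trans z≤n j<n , refl
skip-surjective {suc n} (suc j) (suc p) (s<s j<n) (s<s p<n) j≢p
  with q , q<n , eq ← skip-surjective j p j<n p<n (j≢p ∘ cong suc)
  = suc q , s<s q<n , cong suc eq

-- Deleting a column other than `p` and `suc p` leaves these two side by side in the minor.
skip-adjacent : ∀ {n} j p → j < suc n → suc p < suc n → j ≢ p → j ≢ suc p →
  ∃ λ q → suc q < n × skip j q ≡ p × skip j (suc q) ≡ suc p
skip-adjacent zero    zero    _ _ j≢p _ = contradiction refl j≢p
skip-adjacent zero    (suc p) _ (s<s p<n) _ _ = p , p<n , refl , refl
skip-adjacent (suc zero) zero _ _ _ j≢1 = contradiction refl j≢1
skip-adjacent (suc (suc j)) zero (s<s j<n) _ _ _ =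
  zero , ℕₚ.≤-<-trans (s≤s z≤n) j<n , refl , refl
skip-adjacent {suc n} (suc j) (suc p) (s<s j<n) (s<s p<n) j≢p j≢p′
  with q , q<n , eq , eq′ ← skip-adjacent j p j<n p<n (j≢p ∘ cong suc) (j≢p′ ∘ cong suc)
  = suc q , s<s q<n , cong suc eq , cong suc eq′

-- Deleting column `p` and deleting column `suc p` give the same columns except in one place, where
-- the survivor of the two stands.
skip-suc : ∀ p k → skip p k ≡ skip (suc p) k ⊎ (skip p k ≡ suc p × skip (suc p) k ≡ p)
skip-suc zero    zero    = inj₂ (refl , refl)
skip-suc zero    (suc k) = inj₁ refl
skip-suc (suc p) zero    = inj₁ refl
skip-suc (suc p) (suc k) with skip-suc p k
... | inj₁ eq         = inj₁ (cong suc eq)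
... | inj₂ (eq , eq′) = inj₂ (cong suc eq , cong suc eq′)

-- The alternating sum f 0 - f 1 + f 2 - ..., with the signs carried by the recursion instead of
-- powers of -1.
alt : ℕ → (ℕ → ℚ) → ℚ
alt zero    f = 0ℚ
alt (suc n) f = f zero ℚ.- alt n (f ∘ suc)

alt-cong : ∀ n {f g} → (∀ j → j < n → f j ≡ g j) → alt n f ≡ alt n g
alt-cong zero    eq = refl
alt-cong (suc n) eq = cong₂ ℚ._-_ (eq zero z<s) (alt-cong n λ j j<n → eq (suc j) (s<s j<n))

alt-linear : ∀ n k f g → alt n (λ j → f j ℚ.+ k ℚ.* g j) ≡ alt n f ℚ.+ k ℚ.* alt n g
alt-linear zero    k f g = sym (trans (ℚₚ.+-identityˡ _) (ℚₚ.*-zeroʳ k))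
alt-linear (suc n) k f g = trans
  (cong (λ x → (f zero ℚ.+ k ℚ.* g zero) ℚ.- x) (alt-linear n k (f ∘ suc) (g ∘ suc)))
  (solve 5 (λ f₀ g₀ k x y →
     (f₀ :+ k :* g₀) :- (x :+ k :* y) := (f₀ :- x) :+ k :* (g₀ :- y))
   refl (f zero) (g zero) k (alt n (f ∘ suc)) (alt n (g ∘ suc)))

alt-zero : ∀ n {f} → (∀ j → j < n → f j ≡ 0ℚ) → alt n f ≡ 0ℚ
alt-zero zero    eq = refl
alt-zero (suc n) eq =
  cong₂ ℚ._-_ (eq zero z<s) (alt-zero n λ j j<n → eq (suc j) (s<s j<n))

alt-cancel : ∀ n p {f} → suc p < n → f p ≡ f (suc p) →
  (∀ j → j < n → j ≢ p → j ≢ suc p → f j ≡ 0ℚ) → alt n f ≡ 0ℚ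
alt-cancel (suc zero) zero (s<s ())
alt-cancel (suc (suc n)) zero {f} _ eq zeros = begin
  f 0 ℚ.- (f 1 ℚ.- alt n (λ j → f (suc (suc j))))
    ≡⟨ cong₂ (λ x y → x ℚ.- (f 1 ℚ.- y)) eq
         (alt-zero n λ j j<n → zeros (suc (suc j)) (s<s (s<s j<n)) (λ ()) (λ ())) ⟩
  f 1 ℚ.- (f 1 ℚ.- 0ℚ)
    ≡⟨ solve 1 (λ x → x :- (x :- con 0ℚ) := con 0ℚ) refl (f 1) ⟩
  0ℚ ∎
alt-cancel (suc n) (suc p) (s<s p<n) eq zeros = cong₂ ℚ._-_
  (zeros zero z<s (λ ()) (λ ()))
  (alt-cancel n p p<n eq λ j j<n j≢p j≢p′ →
    zeros (suc j) (s<s j<n) (j≢p ∘ ℕₚ.suc-injective) (j≢p′ ∘ ℕₚ.suc-injective))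

sum-alt : ∀ n (f g : ℕ → ℚ) →
  sum {n} (λ j → (ℚ.- 1ℚ) ^ toℕ j ℚ.* f (toℕ j) ℚ.* g (toℕ j)) ≡
  alt n (λ j → f j ℚ.* g j)
sum-alt zero    f g = refl
sum-alt (suc n) f g = cong₂ ℚ._+_
  (cong (ℚ._* g 0) (ℚₚ.*-identityˡ (f 0)))
  (begin
    sum {n} (λ j → (ℚ.- 1ℚ) ℚ.* (ℚ.- 1ℚ) ^ toℕ j ℚ.* f (suc (toℕ j)) ℚ.* g (suc (toℕ j)))
      ≡⟨ sum-cong-≗ {n} (λ j →
           solve 3 (λ s x y → con (ℚ.- 1ℚ) :* s :* x :* y := con (ℚ.- 1ℚ) :* (s :* x :* y))
             refl ((ℚ.- 1ℚ) ^ toℕ j) (f (suc (toℕ j))) (g (suc (toℕ j)))) ⟩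
    sum {n} (λ j → (ℚ.- 1ℚ) ℚ.* ((ℚ.- 1ℚ) ^ toℕ j ℚ.* f (suc (toℕ j)) ℚ.* g (suc (toℕ j))))
      ≡⟨ *-distribˡ-sum {n} (ℚ.- 1ℚ) _ ⟨
    (ℚ.- 1ℚ) ℚ.* sum {n} (λ j → (ℚ.- 1ℚ) ^ toℕ j ℚ.* f (suc (toℕ j)) ℚ.* g (suc (toℕ j)))
      ≡⟨ cong ((ℚ.- 1ℚ) ℚ.*_) (sum-alt n (f ∘ suc) (g ∘ suc)) ⟩
    (ℚ.- 1ℚ) ℚ.* alt n (λ j → f (suc j) ℚ.* g (suc j))
      ≡⟨ solve 1 (λ x → con (ℚ.- 1ℚ) :* x := :- x) refl _ ⟩
    ℚ.- alt n (λ j → f (suc j) ℚ.* g (suc j)) ∎)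

minor : Columns → ℕ → Columns
minor c j k i = c (skip j k) (suc i)

expansionTerm : ℕ → Columns → ℕ → ℚ
expansionTerm n c j = c j 0 ℚ.* D n (minor c j)

D-expand : ∀ n c → D (suc n) c ≡ alt (suc n) (expansionTerm n c)
D-expand n c = trans
  (sum-cong-≗ λ j → cong ((ℚ.- 1ℚ) ^ toℕ j ℚ.* c (toℕ j) 0 ℚ.*_)
    (det-cong {n} λ i k → cong (λ l → c l (suc (toℕ i))) (toℕ-punchIn j k)))
  (sum-alt (suc n) (λ j → c j 0) (λ j → D n (minor c j)))

-- In the term of the expansion that deletes column `p`, the first-row entry is linear and the minor
-- does not see the change. In every other term the entry is common to all three and column `p`
-- survives in the minor, which is linear by induction.
D-linear : ∀ n p → p < n → ∀ {a b c} k →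
  (∀ i → c p i ≡ a p i ℚ.+ k ℚ.* b p i) →
  (∀ j → j ≢ p → c j ≗ a j) → (∀ j → j ≢ p → c j ≗ b j) →
  D n c ≡ D n a ℚ.+ k ℚ.* D n b
D-linear (suc n) p p<n {a} {b} {c} k at-p off-a off-b = begin
  D (suc n) c
    ≡⟨ D-expand n c ⟩
  alt (suc n) (expansionTerm n c)
    ≡⟨ alt-cong (suc n) terms ⟩
  alt (suc n) (λ j → expansionTerm n a j ℚ.+ k ℚ.* expansionTerm n b j)
    ≡⟨ alt-linear (suc n) k (expansionTerm n a) (expansionTerm n b) ⟩
  alt (suc n) (expansionTerm n a) ℚ.+ k ℚ.* alt (suc n) (expansionTerm n b)
    ≡⟨ cong₂ (λ x y → x ℚ.+ k ℚ.* y) (D-expand n a) (D-expand n b) ⟨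
  D (suc n) a ℚ.+ k ℚ.* D (suc n) b ∎
  where
  terms : ∀ j → j < suc n →
    expansionTerm n c j ≡ expansionTerm n a j ℚ.+ k ℚ.* expansionTerm n b j
  terms j j<n with j ℕₚ.≟ p
  ... | yes refl = begin
    c p 0 ℚ.* D n (minor c p)
      ≡⟨ cong (ℚ._* D n (minor c p)) (at-p 0) ⟩
    (a p 0 ℚ.+ k ℚ.* b p 0) ℚ.* D n (minor c p)
      ≡⟨ solve 4 (λ x y k d → (x :+ k :* y) :* d := x :* d :+ k :* (y :* d))
           refl (a p 0) (b p 0) k (D n (minor c p)) ⟩
    a p 0 ℚ.* D n (minor c p) ℚ.+ k ℚ.* (b p 0 ℚ.* D n (minor c p))
      ≡⟨ cong₂ (λ x y → a p 0 ℚ.* x ℚ.+ k ℚ.* (b p 0 ℚ.* y))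
           (D-cong n λ l _ i → off-a (skip p l) (skip-≢ p l) (suc i))
           (D-cong n λ l _ i → off-b (skip p l) (skip-≢ p l) (suc i)) ⟩
    expansionTerm n a p ℚ.+ k ℚ.* expansionTerm n b p ∎
  ... | no j≢p with q , q<n , refl ← skip-surjective j p j<n p<n j≢p = begin
    c j 0 ℚ.* D n (minor c j)
      ≡⟨ cong (c j 0 ℚ.*_) (D-linear n q q<n k (at-p ∘ suc)
           (λ l l≢q i → off-a (skip j l) (l≢q ∘ skip-injective j) (suc i))
           (λ l l≢q i → off-b (skip j l) (l≢q ∘ skip-injective j) (suc i))) ⟩
    c j 0 ℚ.* (D n (minor a j) ℚ.+ k ℚ.* D n (minor b j))
      ≡⟨ solve 4 (λ x k y z → x :* (y :+ k :* z) := x :* y :+ k :* (x :* z))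
           refl (c j 0) k (D n (minor a j)) (D n (minor b j)) ⟩
    c j 0 ℚ.* D n (minor a j) ℚ.+ k ℚ.* (c j 0 ℚ.* D n (minor b j))
      ≡⟨ cong₂ (λ x y → x ℚ.* D n (minor a j) ℚ.+ k ℚ.* (y ℚ.* D n (minor b j)))
           (off-a j j≢p 0) (off-b j j≢p 0) ⟩
    expansionTerm n a j ℚ.+ k ℚ.* expansionTerm n b j ∎

-- Deleting any other column leaves two equal neighbours, so that minor vanishes by induction. The
-- two remaining terms have equal minors and equal entries, and carry opposite signs.
D-adjacent : ∀ n p c → suc p < n → c p ≗ c (suc p) → D n c ≡ 0ℚ
D-adjacent (suc n) p c p<n eq = trans (D-expand n c)
  (alt-cancel (suc n) p p<n (cong₂ ℚ._*_ (eq 0) (D-cong n minors)) zeros)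
  where
  minors : ∀ k → k < n → minor c p k ≗ minor c (suc p) k
  minors k _ i with skip-suc p k
  ... | inj₁ e        = cong (λ l → c l (suc i)) e
  ... | inj₂ (e , e′) = begin
    c (skip p k) (suc i)       ≡⟨ cong (λ l → c l (suc i)) e ⟩
    c (suc p) (suc i)          ≡⟨ eq (suc i) ⟨
    c p (suc i)                ≡⟨ cong (λ l → c l (suc i)) e′ ⟨
    c (skip (suc p) k) (suc i) ∎

  zeros : ∀ j → j < suc n → j ≢ p → j ≢ suc p → expansionTerm n c j ≡ 0ℚ
  zeros j j<n j≢p j≢p′ with q , q<n , e , e′ ← skip-adjacent j p j<n p<n j≢p j≢p′ =
    trans (cong (c j 0 ℚ.*_) (D-adjacent n q (minor c j) q<n λ i → begin
      c (skip j q) (suc i)       ≡⟨ cong (λ l → c l (suc i)) e ⟩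
      c p (suc i)                ≡⟨ eq (suc i) ⟩
      c (suc p) (suc i)          ≡⟨ cong (λ l → c l (suc i)) e′ ⟨
      c (skip j (suc q)) (suc i) ∎))
    (ℚₚ.*-zeroʳ (c j 0))

-- Replacing and exchanging columns

update : Columns → ℕ → (ℕ → ℚ) → Columns
update c zero    v zero    = v
update c zero    v (suc j) = c (suc j)
update c (suc p) v zero    = c zero
update c (suc p) v (suc j) = update (c ∘ suc) p v j

update-at : ∀ c p v → update c p v p ≡ v
update-at c zero    v = refl
update-at c (suc p) v = update-at (c ∘ suc) p v

update-off : ∀ c p v {j} → j ≢ p → update c p v j ≡ c j
update-off c zero    v {zero}  j≢p = contradiction refl j≢p
update-off c zero    v {suc j} j≢p = refl
update-off c (suc p) v {zero}  j≢p = refl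
update-off c (suc p) v {suc j} j≢p = update-off (c ∘ suc) p v (j≢p ∘ cong suc)

D-update : ∀ n p c → p < n → ∀ k v w u → (∀ i → u i ≡ v i ℚ.+ k ℚ.* w i) →
  D n (update c p u) ≡ D n (update c p v) ℚ.+ k ℚ.* D n (update c p w)
D-update n p c p<n k v w u eq = D-linear n p p<n k at-p
  (λ j j≢p i → cong-app (trans (update-off c p u j≢p) (sym (update-off c p v j≢p))) i)
  (λ j j≢p i → cong-app (trans (update-off c p u j≢p) (sym (update-off c p w j≢p))) i)
  where
  at-p : ∀ i → update c p u p i ≡ update c p v p i ℚ.+ k ℚ.* update c p w p i
  at-p i rewrite update-at c p u | update-at c p v | update-at c p w = eq i

update₂ : Columns → ℕ → (ℕ → ℚ) → (ℕ → ℚ) → Columns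
update₂ c p u v = update (update c (suc p) v) p u

update₂-at : ∀ c p u v → update₂ c p u v p ≡ u
update₂-at c p u v = update-at _ p u

update₂-at-suc : ∀ c p u v → update₂ c p u v (suc p) ≡ v
update₂-at-suc c p u v =
  trans (update-off _ p u (ℕₚ.1+n≢n)) (update-at c (suc p) v)

update₂-off : ∀ c p u v {j} → j ≢ p → j ≢ suc p → update₂ c p u v j ≡ c j
update₂-off c p u v j≢p j≢p′ = trans (update-off _ p u j≢p) (update-off c (suc p) v j≢p′)

update₂-self : ∀ c p j → update₂ c p (c p) (c (suc p)) j ≡ c j
update₂-self c p j with j ℕₚ.≟ p | j ℕₚ.≟ suc p
... | yes refl | _        = update₂-at c p _ _
... | no _     | yes refl = update₂-at-suc c p _ _
... | no j≢p   | no j≢p′  = update₂-off c p _ _ j≢p j≢p′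

-- Expand E (u + v) (u + v) = 0, where E x y has x and y in the columns p and p + 1.
D-swap : ∀ n p c → suc p < n →
  D n (update₂ c p (c p) (c (suc p))) ≡ ℚ.- D n (update₂ c p (c (suc p)) (c p))
D-swap n p c p<n = begin
  E u v
    ≡⟨ solve 3 (λ x y s → x := (s :+ con 1ℚ :* x) :- s) refl (E u v) (E v u) (E u u) ⟩
  (E u u ℚ.+ 1ℚ ℚ.* E u v) ℚ.- E u u
    ≡⟨ cong₂ ℚ._-_ (sym (linearʳ u)) (vanish u) ⟩
  E u w ℚ.- 0ℚ
    ≡⟨ solve 3 (λ x y z → x :- con 0ℚ := (x :+ con 1ℚ :* (y :+ con 1ℚ :* z)) :- z :- y)
         refl (E u w) (E v u) (E v v) ⟩
  (E u w ℚ.+ 1ℚ ℚ.* (E v u ℚ.+ 1ℚ ℚ.* E v v)) ℚ.- E v v ℚ.- E v u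
    ≡⟨ cong₂ (λ x y → (E u w ℚ.+ 1ℚ ℚ.* x) ℚ.- y ℚ.- E v u) (sym (linearʳ v)) (vanish v) ⟩
  (E u w ℚ.+ 1ℚ ℚ.* E v w) ℚ.- 0ℚ ℚ.- E v u
    ≡⟨ cong (λ x → x ℚ.- 0ℚ ℚ.- E v u) (trans (sym linearˡ) (vanish w)) ⟩
  0ℚ ℚ.- 0ℚ ℚ.- E v u
    ≡⟨ solve 1 (λ x → con 0ℚ :- con 0ℚ :- x := :- x) refl (E v u) ⟩
  ℚ.- E v u ∎
  where
  u v w : ℕ → ℚ
  u = c p
  v = c (suc p)
  w i = u i ℚ.+ 1ℚ ℚ.* v i

  E : (ℕ → ℚ) → (ℕ → ℚ) → ℚ
  E x y = D n (update₂ c p x y)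

  vanish : ∀ x → E x x ≡ 0ℚ
  vanish x = D-adjacent n p (update₂ c p x x) p<n
    (cong-app (trans (update₂-at c p x x) (sym (update₂-at-suc c p x x))))

  linearˡ : E w w ≡ E u w ℚ.+ 1ℚ ℚ.* E v w
  linearˡ = D-update n p _ (ℕₚ.<-trans (ℕₚ.n<1+n p) p<n) 1ℚ u v w λ _ → refl

  linearʳ : ∀ x → E x w ≡ E x u ℚ.+ 1ℚ ℚ.* E x v
  linearʳ x = D-linear n (suc p) p<n 1ℚ at-p (off w u) (off w v)
    where
    at-p : ∀ i → update₂ c p x w (suc p) i ≡
      update₂ c p x u (suc p) i ℚ.+ 1ℚ ℚ.* update₂ c p x v (suc p) i
    at-p i rewrite update₂-at-suc c p x u | update₂-at-suc c p x v | update₂-at-suc c p x w = refl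
    off : ∀ y z j → j ≢ suc p → update₂ c p x y j ≗ update₂ c p x z j
    off y z j j≢p′ i with j ℕₚ.≟ p
    ... | yes refl = cong-app (trans (update₂-at c p x y) (sym (update₂-at c p x z))) i
    ... | no j≢p   = cong-app
      (trans (update₂-off c p x y j≢p j≢p′) (sym (update₂-off c p x z j≢p j≢p′))) i

-- Induction on the number `g` of columns in between: exchanging the right-hand copy with its left
-- neighbour brings it one step closer to column `p`, at the cost of a sign.
D-equal-columns : ∀ n g p c → suc (g + p) < n → c p ≗ c (suc (g + p)) → D n c ≡ 0ℚ
D-equal-columns n zero    p c q<n eq = D-adjacent n p c q<n eq
D-equal-columns n (suc g) p c q<n eq = begin
  D n c
    ≡⟨ D-cong n (λ j _ → cong-app (sym (update₂-self c r j))) ⟩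
  D n (update₂ c r (c r) (c (suc r)))
    ≡⟨ D-swap n r c q<n ⟩
  ℚ.- D n c′
    ≡⟨ cong ℚ.-_ (D-equal-columns n g p c′ (ℕₚ.<-trans (ℕₚ.n<1+n r) q<n) λ i → begin
         c′ p i     ≡⟨ cong-app (update₂-off c r _ _ (ℕₚ.<⇒≢ p<r)
                         (ℕₚ.<⇒≢ (ℕₚ.m<n⇒m<1+n p<r))) i ⟩
         c p i       ≡⟨ eq i ⟩
         c (suc r) i ≡⟨ cong-app (update₂-at c r _ _) i ⟨
         c′ r i ∎) ⟩
  0ℚ ∎
  where
  r : ℕ
  r = suc (g + p)

  c′ : Columns
  c′ = update₂ c r (c (suc r)) (c r)

  p<r : p < r
  p<r = s≤s (ℕₚ.m≤n+m p g)

-- Triangular changes of columns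

data Span (c : Columns) (k : ℕ) : (ℕ → ℚ) → Set where
  zero : ∀ {f} → (∀ i → f i ≡ 0ℚ) → Span c k f
  add  : ∀ {f g} e l → l < k → Span c k g →
    (∀ i → f i ≡ g i ℚ.+ e ℚ.* c l i) → Span c k f

span-cong : ∀ {c c′ k f} → (∀ j → j < k → c j ≗ c′ j) → Span c k f → Span c′ k f
span-cong eq (zero f≡0) = zero f≡0
span-cong eq (add {g = g} e l l<k s f≡) = add e l l<k (span-cong eq s) λ i →
  trans (f≡ i) (cong (λ x → g i ℚ.+ e ℚ.* x) (eq l l<k i))

D-span : ∀ n c k → k < n → ∀ {f} → Span c k f → D n (update c k f) ≡ 0ℚ
-- A zero column satisfies f = f + (-1) f, so linearity makes the determinant equal to its
-- difference with itself.
D-span n c k k<n {f} (zero f≡0) = begin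
  D n (update c k f)
    ≡⟨ D-update n k c k<n (ℚ.- 1ℚ) f f f (λ i →
         trans (f≡0 i) (sym (cong₂ (λ x y → x ℚ.+ (ℚ.- 1ℚ) ℚ.* y) (f≡0 i) (f≡0 i)))) ⟩
  D n (update c k f) ℚ.+ (ℚ.- 1ℚ) ℚ.* D n (update c k f)
    ≡⟨ solve 1 (λ x → x :+ con (ℚ.- 1ℚ) :* x := con 0ℚ) refl (D n (update c k f)) ⟩
  0ℚ ∎
D-span n c k k<n {f} (add {g = g} e l l<k s f≡) = begin
  D n (update c k f)
    ≡⟨ D-update n k c k<n e g (c l) f f≡ ⟩
  D n (update c k g) ℚ.+ e ℚ.* D n (update c k (c l))
    ≡⟨ cong₂ (λ x y → x ℚ.+ e ℚ.* y) (D-span n c k k<n s) repeated ⟩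
  0ℚ ℚ.+ e ℚ.* 0ℚ
    ≡⟨ solve 1 (λ x → con 0ℚ :+ x :* con 0ℚ := con 0ℚ) refl e ⟩
  0ℚ ∎
  where
  repeated : D n (update c k (c l)) ≡ 0ℚ
  repeated with g , refl ← ℕₚ.m≤n⇒∃[o]m+o≡n l<k = D-equal-columns n g l (update c k (c l))
    (subst (λ m → suc m < n) (ℕₚ.+-comm l g) k<n)
    (cong-app (begin
      update c k (c l) l
        ≡⟨ update-off c k (c l) (ℕₚ.<⇒≢ l<k) ⟩
      c l
        ≡⟨ update-at c k (c l) ⟨
      update c k (c l) (suc (l + g))
        ≡⟨ cong (update c k (c l) ∘ suc) (ℕₚ.+-comm l g) ⟩
      update c k (c l) (suc (g + l)) ∎))

record Leading (c : Columns) (d : ℚ) (k : ℕ) (f : ℕ → ℚ) : Set where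
  constructor leading
  field
    {rest}  : ℕ → ℚ
    in-span : Span c k rest
    split   : ∀ i → f i ≡ rest i ℚ.+ d ℚ.* c k i

leading-cong : ∀ {c c′ d k f} → (∀ j → j ≤ k → c j ≗ c′ j) → Leading c d k f → Leading c′ d k f
leading-cong {d = d} {k} eq (leading {r} s f≡) = leading
  (span-cong (λ j j<k → eq j (ℕₚ.<⇒≤ j<k)) s)
  (λ i → trans (f≡ i) (cong (λ x → r i ℚ.+ d ℚ.* x) (eq k ℕₚ.≤-refl i)))

prod : ℕ → (ℕ → ℚ) → ℚ
prod zero    d = 1ℚ
prod (suc n) d = prod n d ℚ.* d n

-- The columns of `c` are replaced by those of `f` from the last one down. When column `k` is
-- replaced, the columns before it are still those of `c`, so the remainder of `f k` lies in their
-- span and contributes nothing.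
D-triangular-upto : ∀ n k → k ≤ n → ∀ d c f →
  (∀ j → j < k → Leading c (d j) j (f j)) →
  (∀ j → k ≤ j → j < n → f j ≗ c j) →
  D n f ≡ prod k d ℚ.* D n c
D-triangular-upto n zero    _   d c f _     same =
  trans (D-cong n λ j → same j z≤n) (sym (ℚₚ.*-identityˡ (D n c)))
D-triangular-upto n (suc k) k<n d c f heads same = begin
  D n f
    ≡⟨ D-triangular-upto n k (ℕₚ.<⇒≤ k<n) d c′ f heads′ same′ ⟩
  prod k d ℚ.* D n c′
    ≡⟨ cong (prod k d ℚ.*_) (D-update n k c k<n (d k) rest (c k) (f k) split) ⟩
  prod k d ℚ.* (D n (update c k rest) ℚ.+ d k ℚ.* D n (update c k (c k)))
    ≡⟨ cong₂ (λ x y → prod k d ℚ.* (x ℚ.+ d k ℚ.* y)) (D-span n c k k<n in-span)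
         (D-cong n λ j _ → cong-app (update-self j)) ⟩
  prod k d ℚ.* (0ℚ ℚ.+ d k ℚ.* D n c)
    ≡⟨ solve 3 (λ x y z → x :* (con 0ℚ :+ y :* z) := x :* y :* z)
         refl (prod k d) (d k) (D n c) ⟩
  prod k d ℚ.* d k ℚ.* D n c ∎
  where
  open Leading (heads k (ℕₚ.n<1+n k))

  c′ : Columns
  c′ = update c k (f k)

  heads′ : ∀ j → j < k → Leading c′ (d j) j (f j)
  heads′ j j<k = leading-cong
    (λ l l≤j → cong-app (sym (update-off c k (f k) (ℕₚ.<⇒≢ (ℕₚ.≤-<-trans l≤j j<k)))))
    (heads j (ℕₚ.m<n⇒m<1+n j<k))

  same′ : ∀ j → k ≤ j → j < n → f j ≗ c′ j
  same′ j k≤j j<n i with j ℕₚ.≟ k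
  ... | yes refl = sym (cong-app (update-at c j (f j)) i)
  ... | no j≢k   = trans (same j (ℕₚ.≤∧≢⇒< k≤j (≢-sym j≢k)) j<n i)
    (sym (cong-app (update-off c k (f k) j≢k) i))

  update-self : ∀ j → update c k (c k) j ≡ c j
  update-self j with j ℕₚ.≟ k
  ... | yes refl = update-at c j (c j)
  ... | no j≢k   = update-off c k (c k) j≢k

D-triangular : ∀ n d c f → (∀ j → Leading c (d j) j (f j)) → D n f ≡ prod n d ℚ.* D n c
D-triangular n d c f heads = D-triangular-upto n n ℕₚ.≤-refl d c f
  (λ j _ → heads j) (λ j n≤j j<n → contradiction j<n (ℕₚ.≤⇒≯ n≤j))

span-scale : ∀ {c k f} x → Span c k f → Span c k (λ i → x ℚ.* f i)
span-scale x (zero f≡0) = zero λ i → trans (cong (x ℚ.*_) (f≡0 i)) (ℚₚ.*-zeroʳ x)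
span-scale {c} x (add {g = g} e l l<k s f≡) = add (x ℚ.* e) l l<k (span-scale x s) λ i →
  trans (cong (x ℚ.*_) (f≡ i))
    (solve 4 (λ x y e z → x :* (y :+ e :* z) := x :* y :+ x :* e :* z) refl x (g i) e (c l i))

span-+ : ∀ {c k f g} → Span c k f → Span c k g → Span c k (λ i → f i ℚ.+ g i)
-- Membership in a span is stated up to pointwise equality. Adding a zero function therefore changes
-- only the outermost equation of the derivation.
span-+ {f = f} {g} s (zero g≡0) = respects s
  where
  respects : ∀ {c k} → Span c k f → Span c k (λ i → f i ℚ.+ g i)
  respects (zero f≡0) = zero λ i → cong₂ ℚ._+_ (f≡0 i) (g≡0 i)
  respects (add e l l<k s′ f≡) = add e l l<k s′ λ i →
    trans (cong (f i ℚ.+_) (g≡0 i)) (trans (ℚₚ.+-identityʳ (f i)) (f≡ i))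
span-+ {f = f} s (add e l l<k t g≡) = add e l l<k (span-+ s t) λ i →
  trans (cong (f i ℚ.+_) (g≡ i)) (sym (ℚₚ.+-assoc (f i) _ _))

span-weaken : ∀ {c k k′ f} → k ≤ k′ → Span c k f → Span c k′ f
span-weaken k≤k′ (zero f≡0)         = zero f≡0
span-weaken k≤k′ (add e l l<k s f≡) = add e l (ℕₚ.<-≤-trans l<k k≤k′) (span-weaken k≤k′ s) f≡

-- Reading every column one row further down turns column `l` into column `l + 2`, so the bound
-- rises by two.
span-shift : ∀ {c} → (∀ j i → c j (suc i) ≡ c (suc (suc j)) i) →
  ∀ {k f} → Span c k f → Span c (suc (suc k)) (f ∘ suc)
span-shift hankel (zero f≡0) = zero (f≡0 ∘ suc)
span-shift hankel (add {g = g} e l l<k s f≡) =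
  add e (suc (suc l)) (s<s (s<s l<k)) (span-shift hankel s) λ i →
    trans (f≡ (suc i)) (cong (λ x → g (suc i) ℚ.+ e ℚ.* x) (hankel l i))

-- The exponent of 2

τ-suc : ∀ n → τ (suc n) ≡ τ n + ⌊ n /2⌋
τ-suc n = begin
  -- From `n` to `n + 1` the two halves change places and the former floor grows by one, all by
  -- computation. Only its binomial coefficient changes, by Pascal's rule.
  (suc ⌊ n /2⌋ C 2) + (⌈ n /2⌉ C 2)
    ≡⟨ cong (_+ (⌈ n /2⌉ C 2)) (begin
         suc ⌊ n /2⌋ C 2             ≡⟨ nCk+nC[k+1]≡[n+1]C[k+1] ⌊ n /2⌋ 1 ⟨
         ⌊ n /2⌋ C 1 + ⌊ n /2⌋ C 2   ≡⟨ cong (_+ ⌊ n /2⌋ C 2) (nC1≡n ⌊ n /2⌋) ⟩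
         ⌊ n /2⌋ + ⌊ n /2⌋ C 2       ∎) ⟩
  (⌊ n /2⌋ + (⌊ n /2⌋ C 2)) + (⌈ n /2⌉ C 2)
    ≡⟨ ℕₚ.+-assoc ⌊ n /2⌋ _ _ ⟩
  ⌊ n /2⌋ + ((⌊ n /2⌋ C 2) + (⌈ n /2⌉ C 2))
    ≡⟨ cong (⌊ n /2⌋ +_) (ℕₚ.+-comm (⌊ n /2⌋ C 2) _) ⟩
  ⌊ n /2⌋ + τ n
    ≡⟨ ℕₚ.+-comm ⌊ n /2⌋ (τ n) ⟩
  τ n + ⌊ n /2⌋ ∎

prod-τ : ∀ n → prod n (λ j → 2ℚ ^ ⌊ j /2⌋) ≡ 2ℚ ^ τ n
prod-τ zero    = refl
prod-τ (suc n) = begin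
  prod n (λ j → 2ℚ ^ ⌊ j /2⌋) ℚ.* 2ℚ ^ ⌊ n /2⌋
    ≡⟨ cong (ℚ._* 2ℚ ^ ⌊ n /2⌋) (prod-τ n) ⟩
  2ℚ ^ τ n ℚ.* 2ℚ ^ ⌊ n /2⌋
    ≡⟨ ^-homo-* 2ℚ (τ n) ⌊ n /2⌋ ⟨
  2ℚ ^ (τ n + ⌊ n /2⌋)
    ≡⟨ cong (2ℚ ^_) (τ-suc n) ⟨
  2ℚ ^ τ (suc n) ∎

-- Palindromic polynomials

coeff : Poly → ℕ → ℚ
coeff []      n       = 0ℚ
coeff (c ∷ p) zero    = c
coeff (c ∷ p) (suc n) = coeff p n

infix 4 _≈_
-- Equality of the represented polynomials, insensitive to trailing zeros.
_≈_ : Poly → Poly → Set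
p ≈ q = coeff p ≗ coeff q

coeff-⊕ : ∀ p q n → coeff (p ⊕ q) n ≡ coeff p n ℚ.+ coeff q n
coeff-⊕ []      q       n       = sym (ℚₚ.+-identityˡ (coeff q n))
coeff-⊕ (c ∷ p) []      n       = sym (ℚₚ.+-identityʳ (coeff (c ∷ p) n))
coeff-⊕ (c ∷ p) (d ∷ q) zero    = refl
coeff-⊕ (c ∷ p) (d ∷ q) (suc n) = coeff-⊕ p q n

coeff-· : ∀ k p n → coeff (k · p) n ≡ k ℚ.* coeff p n
coeff-· k []      n       = sym (ℚₚ.*-zeroʳ k)
coeff-· k (c ∷ p) zero    = refl
coeff-· k (c ∷ p) (suc n) = coeff-· k p n

∷-cong : ∀ {c p q} → p ≈ q → c ∷ p ≈ c ∷ q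
∷-cong p≈q zero    = refl
∷-cong p≈q (suc n) = p≈q n

⊕-cong : ∀ p p′ q q′ → p ≈ p′ → q ≈ q′ → p ⊕ q ≈ p′ ⊕ q′
⊕-cong p p′ q q′ p≈p′ q≈q′ n =
  trans (coeff-⊕ p q n) (trans (cong₂ ℚ._+_ (p≈p′ n) (q≈q′ n)) (sym (coeff-⊕ p′ q′ n)))

0∷-zero : ∀ {p} → p ≈ [] → 0ℚ ∷ p ≈ []
0∷-zero p≈0 zero    = refl
0∷-zero p≈0 (suc n) = p≈0 n

coeff-⊗-∷ : ∀ c p q n → coeff ((c ∷ p) ⊗ q) n ≡ c ℚ.* coeff q n ℚ.+ coeff (0ℚ ∷ p ⊗ q) n
coeff-⊗-∷ c p q n = trans (coeff-⊕ (c · q) (0ℚ ∷ p ⊗ q) n)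
  (cong (ℚ._+ coeff (0ℚ ∷ p ⊗ q) n) (coeff-· c q n))

⊗-zeroˡ : ∀ p q → p ≈ [] → p ⊗ q ≈ []
⊗-zeroˡ []      q p≈0 n = refl
⊗-zeroˡ (c ∷ p) q p≈0 n = begin
  coeff ((c ∷ p) ⊗ q) n
    ≡⟨ coeff-⊗-∷ c p q n ⟩
  c ℚ.* coeff q n ℚ.+ coeff (0ℚ ∷ p ⊗ q) n
    ≡⟨ cong₂ (λ x y → x ℚ.* coeff q n ℚ.+ y) (p≈0 0) (0∷-zero (⊗-zeroˡ p q (p≈0 ∘ suc)) n) ⟩
  0ℚ ℚ.* coeff q n ℚ.+ 0ℚ
    ≡⟨ solve 1 (λ x → con 0ℚ :* x :+ con 0ℚ := con 0ℚ) refl (coeff q n) ⟩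
  0ℚ ∎

⊗-congˡ : ∀ p p′ q → p ≈ p′ → p ⊗ q ≈ p′ ⊗ q
⊗-congˡ []      p′       q eq n = sym (⊗-zeroˡ p′ q (sym ∘ eq) n)
⊗-congˡ (c ∷ p) []       q eq n = ⊗-zeroˡ (c ∷ p) q eq n
⊗-congˡ (c ∷ p) (d ∷ p′) q eq n = begin
  coeff ((c ∷ p) ⊗ q) n
    ≡⟨ coeff-⊗-∷ c p q n ⟩
  c ℚ.* coeff q n ℚ.+ coeff (0ℚ ∷ p ⊗ q) n
    ≡⟨ cong₂ (λ x y → x ℚ.* coeff q n ℚ.+ y) (eq 0)
         (∷-cong (⊗-congˡ p p′ q (eq ∘ suc)) n) ⟩
  d ℚ.* coeff q n ℚ.+ coeff (0ℚ ∷ p′ ⊗ q) n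
    ≡⟨ coeff-⊗-∷ d p′ q n ⟨
  coeff ((d ∷ p′) ⊗ q) n ∎

1ₚ-⊗ : ∀ q → 1ₚ ⊗ q ≈ q
1ₚ-⊗ q n = begin
  coeff (1ₚ ⊗ q) n
    ≡⟨ coeff-⊗-∷ 1ℚ [] q n ⟩
  1ℚ ℚ.* coeff q n ℚ.+ coeff (0ℚ ∷ []) n
    ≡⟨ cong₂ ℚ._+_ (ℚₚ.*-identityˡ (coeff q n)) (0∷-zero (λ _ → refl) n) ⟩
  coeff q n ℚ.+ 0ℚ
    ≡⟨ ℚₚ.+-identityʳ (coeff q n) ⟩
  coeff q n ∎

0∷-⊗ : ∀ p q → (0ℚ ∷ p) ⊗ q ≈ 0ℚ ∷ p ⊗ q
0∷-⊗ p q n = trans (coeff-⊗-∷ 0ℚ p q n)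
  (trans (cong (ℚ._+ coeff (0ℚ ∷ p ⊗ q) n) (ℚₚ.*-zeroˡ (coeff q n))) (ℚₚ.+-identityˡ _))

X-⊗ : ∀ q → X ⊗ q ≈ 0ℚ ∷ q
X-⊗ q n = trans (0∷-⊗ 1ₚ q n) (∷-cong (1ₚ-⊗ q) n)

1+X-⊗ : ∀ q → 1+X ⊗ q ≈ q ⊕ (0ℚ ∷ q)
1+X-⊗ q n = begin
  coeff (1+X ⊗ q) n
    ≡⟨ coeff-⊗-∷ 1ℚ 1ₚ q n ⟩
  1ℚ ℚ.* coeff q n ℚ.+ coeff (0ℚ ∷ 1ₚ ⊗ q) n
    ≡⟨ cong₂ ℚ._+_ (ℚₚ.*-identityˡ (coeff q n)) (∷-cong (1ₚ-⊗ q) n) ⟩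
  coeff q n ℚ.+ coeff (0ℚ ∷ q) n
    ≡⟨ coeff-⊕ q (0ℚ ∷ q) n ⟨
  coeff (q ⊕ (0ℚ ∷ q)) n ∎

Xⁱ⁺¹-⊗ : ∀ i q → X ^ₚ suc i ⊗ q ≈ 0ℚ ∷ X ^ₚ i ⊗ q
Xⁱ⁺¹-⊗ i q n = trans (⊗-congˡ (X ⊗ X ^ₚ i) (0ℚ ∷ X ^ₚ i) q (X-⊗ (X ^ₚ i)) n)
  (0∷-⊗ (X ^ₚ i) q n)

-- The polynomials x^i (1 + x)^j

P : ℕ → ℕ → Poly
P i j = X ^ₚ i ⊗ 1+X ^ₚ j

P-sucˡ : ∀ i j → P (suc i) j ≈ 0ℚ ∷ P i j
P-sucˡ i j = Xⁱ⁺¹-⊗ i (1+X ^ₚ j)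

-- The new factor 1 + x stands behind x^i. Peeling off the powers of x one by one reaches it without
-- appeal to commutativity or associativity of `⊗`.
P-sucʳ : ∀ i j → P i (suc j) ≈ P i j ⊕ (0ℚ ∷ P i j)
P-sucʳ zero j n = begin
  coeff (1ₚ ⊗ (1+X ⊗ 1+X ^ₚ j)) n
    ≡⟨ 1ₚ-⊗ (1+X ⊗ 1+X ^ₚ j) n ⟩
  coeff (1+X ⊗ 1+X ^ₚ j) n
    ≡⟨ 1+X-⊗ (1+X ^ₚ j) n ⟩
  coeff (1+X ^ₚ j ⊕ (0ℚ ∷ 1+X ^ₚ j)) n
    ≡⟨ ⊕-cong (P 0 j) (1+X ^ₚ j) (0ℚ ∷ P 0 j) (0ℚ ∷ 1+X ^ₚ j)
         (1ₚ-⊗ (1+X ^ₚ j)) (∷-cong (1ₚ-⊗ (1+X ^ₚ j))) n ⟨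
  coeff (P 0 j ⊕ (0ℚ ∷ P 0 j)) n ∎
P-sucʳ (suc i) j n = begin
  coeff (P (suc i) (suc j)) n
    ≡⟨ P-sucˡ i (suc j) n ⟩
  coeff (0ℚ ∷ P i (suc j)) n
    ≡⟨ ∷-cong (P-sucʳ i j) n ⟩
  coeff ((0ℚ ∷ P i j) ⊕ (0ℚ ∷ 0ℚ ∷ P i j)) n
    ≡⟨ ⊕-cong (P (suc i) j) (0ℚ ∷ P i j) (0ℚ ∷ P (suc i) j) (0ℚ ∷ 0ℚ ∷ P i j)
         (P-sucˡ i j) (∷-cong (P-sucˡ i j)) n ⟨
  coeff (P (suc i) j ⊕ (0ℚ ∷ P (suc i) j)) n ∎

Xⁱ-P : ∀ i → X ^ₚ i ≈ P i 0
Xⁱ-P zero    n = sym (1ₚ-⊗ 1ₚ n)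
Xⁱ-P (suc i) n = trans (X-⊗ (X ^ₚ i) n) (trans (∷-cong (Xⁱ-P i) n) (sym (P-sucˡ i 0 n)))

1+X-Xⁱ-P : ∀ i → 1+X ⊗ X ^ₚ i ≈ P i 1
1+X-Xⁱ-P i n = begin
  coeff (1+X ⊗ X ^ₚ i) n
    ≡⟨ 1+X-⊗ (X ^ₚ i) n ⟩
  coeff (X ^ₚ i ⊕ (0ℚ ∷ X ^ₚ i)) n
    ≡⟨ ⊕-cong (X ^ₚ i) (P i 0) (0ℚ ∷ X ^ₚ i) (0ℚ ∷ P i 0) (Xⁱ-P i) (∷-cong (Xⁱ-P i)) n ⟩
  coeff (P i 0 ⊕ (0ℚ ∷ P i 0)) n
    ≡⟨ P-sucʳ i 0 n ⟨
  coeff (P i 1) n ∎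

-- Evaluation and division by x - 1

eval-zero : ∀ p t → p ≈ [] → eval p t ≡ 0ℚ
eval-zero []      t p≈0 = refl
eval-zero (c ∷ p) t p≈0 =
  trans (cong₂ (λ x y → x ℚ.+ t ℚ.* y) (p≈0 0) (eval-zero p t (p≈0 ∘ suc)))
    (trans (ℚₚ.+-identityˡ _) (ℚₚ.*-zeroʳ t))

eval-cong : ∀ p q t → p ≈ q → eval p t ≡ eval q t
eval-cong []      q       t p≈q = sym (eval-zero q t (sym ∘ p≈q))
eval-cong (c ∷ p) []      t p≈q = eval-zero (c ∷ p) t p≈q
eval-cong (c ∷ p) (d ∷ q) t p≈q =
  cong₂ (λ x y → x ℚ.+ t ℚ.* y) (p≈q 0) (eval-cong p q t (p≈q ∘ suc))

eval-⊕ : ∀ p q t → eval (p ⊕ q) t ≡ eval p t ℚ.+ eval q t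
eval-⊕ []      q       t = sym (ℚₚ.+-identityˡ (eval q t))
eval-⊕ (c ∷ p) []      t = sym (ℚₚ.+-identityʳ (eval (c ∷ p) t))
eval-⊕ (c ∷ p) (d ∷ q) t = trans (cong (λ x → c ℚ.+ d ℚ.+ t ℚ.* x) (eval-⊕ p q t))
  (solve 5 (λ c d t x y → c :+ d :+ t :* (x :+ y) := (c :+ t :* x) :+ (d :+ t :* y))
    refl c d t (eval p t) (eval q t))

eval-· : ∀ k p t → eval (k · p) t ≡ k ℚ.* eval p t
eval-· k []      t = sym (ℚₚ.*-zeroʳ k)
eval-· k (c ∷ p) t = trans (cong (λ x → k ℚ.* c ℚ.+ t ℚ.* x) (eval-· k p t))
  (solve 4 (λ k c t x → k :* c :+ t :* (k :* x) := k :* (c :+ t :* x))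
    refl k c t (eval p t))

eval-⊕-· : ∀ p k q t → eval (p ⊕ k · q) t ≡ eval p t ℚ.+ k ℚ.* eval q t
eval-⊕-· p k q t = trans (eval-⊕ p (k · q) t) (cong (eval p t ℚ.+_) (eval-· k q t))

-- tailSum p n is the sum of the coefficients of p from the n-th on; for n ≥ 1 these are
-- the coefficients of the quotient by x - 1.
tailSum : Poly → ℕ → ℚ
tailSum p = coeff (eval p 1ℚ ∷ p /[x-1])

tailSum-suc : ∀ p n → tailSum p n ≡ coeff p n ℚ.+ tailSum p (suc n)
tailSum-suc []      zero    = refl
tailSum-suc []      (suc n) = refl
tailSum-suc (c ∷ p) zero    = cong (c ℚ.+_) (ℚₚ.*-identityˡ (eval p 1ℚ))
tailSum-suc (c ∷ p) (suc n) = tailSum-suc p n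

tailSum-zero : ∀ p n → (∀ k → n ≤ k → coeff p k ≡ 0ℚ) → tailSum p n ≡ 0ℚ
tailSum-zero p       zero    zeros = eval-zero p 1ℚ λ k → zeros k z≤n
tailSum-zero []      (suc n) zeros = refl
tailSum-zero (c ∷ p) (suc n) zeros = tailSum-zero p n λ k n≤k → zeros (suc k) (s≤s n≤k)

infix 4 _≈_+[_]_
-- Being a record, it lets the polynomials and the scalar be inferred from a proof, which the bare
-- equations between coefficients would not.
record _≈_+[_]_ (r p : Poly) (k : ℚ) (q : Poly) : Set where
  constructor combination
  field
    coeffwise : ∀ n → coeff r n ≡ coeff p n ℚ.+ k ℚ.* coeff q n
open _≈_+[_]_

-- With scalar 0, invariance under `≈` becomes an instance of linearity, as in `ρᵈ-cong` and
-- `/[x-1]-cong`.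
≈⇒combination : ∀ p q → p ≈ q → p ≈ q +[ 0ℚ ] q
≈⇒combination p q p≈q = combination λ n → trans (p≈q n)
  (solve 1 (λ x → x := x :+ con 0ℚ :* x) refl (coeff q n))

eval-combination : ∀ {r p k q} → r ≈ p +[ k ] q →
  ∀ t → eval r t ≡ eval p t ℚ.+ k ℚ.* eval q t
eval-combination {r} {p} {k} {q} r≈ t = trans
  (eval-cong r (p ⊕ k · q) t λ n → trans (coeffwise r≈ n)
    (sym (trans (coeff-⊕ p (k · q) n) (cong (coeff p n ℚ.+_) (coeff-· k q n)))))
  (eval-⊕-· p k q t)

-- The whole sum is linear because evaluation at 1 is, and each later tail is the previous one minus
-- a coefficient. This avoids a recursion over three lists of different lengths.
tailSum-combination : ∀ {r p k q} → r ≈ p +[ k ] q →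
  ∀ n → tailSum r n ≡ tailSum p n ℚ.+ k ℚ.* tailSum q n
tailSum-combination r≈ zero = eval-combination r≈ 1ℚ
tailSum-combination {r} {p} {k} {q} r≈ (suc n) = begin
  tailSum r (suc n)
    ≡⟨ cancel r ⟩
  tailSum r n ℚ.- coeff r n
    ≡⟨ cong₂ ℚ._-_ (tailSum-combination r≈ n) (coeffwise r≈ n) ⟩
  (tailSum p n ℚ.+ k ℚ.* tailSum q n) ℚ.- (coeff p n ℚ.+ k ℚ.* coeff q n)
    ≡⟨ solve 5 (λ k x y z w → (x :+ k :* y) :- (z :+ k :* w) := (x :- z) :+ k :* (y :- w))
         refl k (tailSum p n) (tailSum q n) (coeff p n) (coeff q n) ⟩
  (tailSum p n ℚ.- coeff p n) ℚ.+ k ℚ.* (tailSum q n ℚ.- coeff q n)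
    ≡⟨ cong₂ (λ x y → x ℚ.+ k ℚ.* y) (cancel p) (cancel q) ⟨
  tailSum p (suc n) ℚ.+ k ℚ.* tailSum q (suc n) ∎
  where
  cancel : ∀ p → tailSum p (suc n) ≡ tailSum p n ℚ.- coeff p n
  cancel p = trans
    (solve 2 (λ x y → y := (x :+ y) :- x) refl (coeff p n) (tailSum p (suc n)))
    (cong (ℚ._- coeff p n) (sym (tailSum-suc p n)))

/[x-1]-combination : ∀ {r p k q} → r ≈ p +[ k ] q → (r /[x-1]) ≈ (p /[x-1]) +[ k ] (q /[x-1])
/[x-1]-combination r≈ = combination (tailSum-combination r≈ ∘ suc)

-- The operator and the evaluation with a prescribed index

numerator : ℕ → Poly → Poly
numerator d p = eval p 1ℚ · (X ^ₚ d ⊕ 1ₚ) ⊕ (ℚ.- 2ℚ) · p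

Nᵈ : ℕ → Poly → Poly
Nᵈ d p = numerator d p /[x-1] /[x-1]

coeff-numerator : ∀ d p n →
  coeff (numerator d p) n ≡ eval p 1ℚ ℚ.* coeff (X ^ₚ d ⊕ 1ₚ) n ℚ.+ (ℚ.- 2ℚ) ℚ.* coeff p n
coeff-numerator d p n = trans (coeff-⊕ (eval p 1ℚ · (X ^ₚ d ⊕ 1ₚ)) ((ℚ.- 2ℚ) · p) n)
  (cong₂ ℚ._+_ (coeff-· (eval p 1ℚ) (X ^ₚ d ⊕ 1ₚ) n) (coeff-· (ℚ.- 2ℚ) p n))

Nᵈ-combination : ∀ d {r p k q} → r ≈ p +[ k ] q → Nᵈ d r ≈ Nᵈ d p +[ k ] Nᵈ d q
Nᵈ-combination d {r} {p} {k} {q} r≈ =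
  /[x-1]-combination (/[x-1]-combination numerators)
  where
  numerators : numerator d r ≈ numerator d p +[ k ] numerator d q
  numerators = combination λ n → let g = coeff (X ^ₚ d ⊕ 1ₚ) n in begin
    coeff (numerator d r) n
      ≡⟨ coeff-numerator d r n ⟩
    eval r 1ℚ ℚ.* g ℚ.+ (ℚ.- 2ℚ) ℚ.* coeff r n
      ≡⟨ cong₂ (λ x y → x ℚ.* g ℚ.+ (ℚ.- 2ℚ) ℚ.* y)
           (eval-combination r≈ 1ℚ) (coeffwise r≈ n) ⟩
    (eval p 1ℚ ℚ.+ k ℚ.* eval q 1ℚ) ℚ.* g ℚ.+ (ℚ.- 2ℚ) ℚ.* (coeff p n ℚ.+ k ℚ.* coeff q n)
      ≡⟨ solve 7 (λ k g s x y z w →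
           (x :+ k :* y) :* g :+ s :* (z :+ k :* w) :=
           (x :* g :+ s :* z) :+ k :* (y :* g :+ s :* w))
           refl k g (ℚ.- 2ℚ) (eval p 1ℚ) (eval q 1ℚ) (coeff p n) (coeff q n) ⟩
    (eval p 1ℚ ℚ.* g ℚ.+ (ℚ.- 2ℚ) ℚ.* coeff p n) ℚ.+
      k ℚ.* (eval q 1ℚ ℚ.* g ℚ.+ (ℚ.- 2ℚ) ℚ.* coeff q n)
      ≡⟨ cong₂ (λ x y → x ℚ.+ k ℚ.* y) (coeff-numerator d p n) (coeff-numerator d q n) ⟨
    coeff (numerator d p) n ℚ.+ k ℚ.* coeff (numerator d q) n ∎

-- ρ with the index prescribed instead of read off from p, which makes it linear.
ρᵈ : ℕ → Poly → ℚ
ρᵈ zero          p = constantTerm p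
ρᵈ (suc zero)    p = constantTerm p
ρᵈ (suc (suc d)) p = ρᵈ d (Nᵈ (suc (suc d)) p)

constantTerm≡coeff : ∀ p → constantTerm p ≡ coeff p 0
constantTerm≡coeff []      = refl
constantTerm≡coeff (c ∷ p) = refl

constantTerm-combination : ∀ {r p k q} → r ≈ p +[ k ] q →
  constantTerm r ≡ constantTerm p ℚ.+ k ℚ.* constantTerm q
constantTerm-combination {r} {p} {k} {q} r≈ = begin
  constantTerm r                             ≡⟨ constantTerm≡coeff r ⟩
  coeff r 0                                  ≡⟨ coeffwise r≈ 0 ⟩
  coeff p 0 ℚ.+ k ℚ.* coeff q 0
    ≡⟨ cong₂ (λ x y → x ℚ.+ k ℚ.* y) (constantTerm≡coeff p) (constantTerm≡coeff q) ⟨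
  constantTerm p ℚ.+ k ℚ.* constantTerm q ∎

ρᵈ-combination : ∀ d {r p k q} → r ≈ p +[ k ] q → ρᵈ d r ≡ ρᵈ d p ℚ.+ k ℚ.* ρᵈ d q
ρᵈ-combination zero          r≈ = constantTerm-combination r≈
ρᵈ-combination (suc zero)    r≈ = constantTerm-combination r≈
ρᵈ-combination (suc (suc d)) r≈ = ρᵈ-combination d (Nᵈ-combination (suc (suc d)) r≈)

ρᵈ-cong : ∀ d p q → p ≈ q → ρᵈ d p ≡ ρᵈ d q
ρᵈ-cong d p q p≈q = trans (ρᵈ-combination d (≈⇒combination p q p≈q))
  (solve 1 (λ x → x :+ con 0ℚ :* x := x) refl (ρᵈ d q))

-- A list of zeros satisfies p = p + (-1) p, so its value is its difference with itself.
ρᵈ-zero : ∀ d p → p ≈ [] → ρᵈ d p ≡ 0ℚ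
ρᵈ-zero d p p≈0 = trans
  (ρᵈ-combination d {k = ℚ.- 1ℚ} (combination λ n → trans (p≈0 n)
    (cong (λ x → x ℚ.+ (ℚ.- 1ℚ) ℚ.* x) (sym (p≈0 n)))))
  (solve 1 (λ x → x :+ con (ℚ.- 1ℚ) :* x := con 0ℚ) refl (ρᵈ d p))

-- Symmetry of the coefficients

-- The sign s = -1 occurs halfway through Nᵈ: dividing by x - 1 flips the sign.
record Palindromic (s : ℚ) (d : ℕ) (p : Poly) : Set where
  field
    symmetric : ∀ n m → n + m ≡ d → coeff p n ≡ s ℚ.* coeff p m
    vanishing : ∀ n → d < n → coeff p n ≡ 0ℚ
open Palindromic

-- The symmetry turns `s` times the tail from `m` on into the sum of the coefficients below `n`. The
-- induction passes one coefficient at a time from one tail to the other.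
tailSum-symmetric : ∀ {s d p} → Palindromic s d p → ∀ n m → n + m ≡ suc d →
  tailSum p n ℚ.+ s ℚ.* tailSum p m ≡ eval p 1ℚ
tailSum-symmetric {s} {d} {p} pal zero .(suc d) refl = begin
  eval p 1ℚ ℚ.+ s ℚ.* tailSum p (suc d)
    ≡⟨ cong (λ x → eval p 1ℚ ℚ.+ s ℚ.* x) (tailSum-zero p (suc d) (vanishing pal)) ⟩
  eval p 1ℚ ℚ.+ s ℚ.* 0ℚ
    ≡⟨ solve 2 (λ x y → x :+ y :* con 0ℚ := x) refl (eval p 1ℚ) s ⟩
  eval p 1ℚ ∎
tailSum-symmetric {s} {d} {p} pal (suc n) m eq = begin
  tailSum p (suc n) ℚ.+ s ℚ.* tailSum p m
    ≡⟨ cong (λ x → tailSum p (suc n) ℚ.+ s ℚ.* x) (tailSum-suc p m) ⟩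
  tailSum p (suc n) ℚ.+ s ℚ.* (coeff p m ℚ.+ tailSum p (suc m))
    ≡⟨ solve 4 (λ s x y z → x :+ s :* (y :+ z) := (s :* y :+ x) :+ s :* z)
         refl s (tailSum p (suc n)) (coeff p m) (tailSum p (suc m)) ⟩
  (s ℚ.* coeff p m ℚ.+ tailSum p (suc n)) ℚ.+ s ℚ.* tailSum p (suc m)
    ≡⟨ cong (λ x → (x ℚ.+ tailSum p (suc n)) ℚ.+ s ℚ.* tailSum p (suc m))
         (symmetric pal n m (ℕₚ.suc-injective eq)) ⟨
  (coeff p n ℚ.+ tailSum p (suc n)) ℚ.+ s ℚ.* tailSum p (suc m)
    ≡⟨ cong (ℚ._+ s ℚ.* tailSum p (suc m)) (tailSum-suc p n) ⟨
  tailSum p n ℚ.+ s ℚ.* tailSum p (suc m)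
    ≡⟨ tailSum-symmetric pal n (suc m) (trans (ℕₚ.+-suc n m) eq) ⟩
  eval p 1ℚ ∎

/[x-1]-palindromic : ∀ {s d p} → Palindromic s (suc d) p → eval p 1ℚ ≡ 0ℚ →
  Palindromic (ℚ.- s) d (p /[x-1])
/[x-1]-palindromic {s} {d} {p} pal p₁≡0 = record
  { symmetric = λ n m n+m≡d → begin
      tailSum p (suc n)
        ≡⟨ solve 3 (λ s x y → x := (x :+ s :* y) :+ (:- s) :* y)
             refl s (tailSum p (suc n)) (tailSum p (suc m)) ⟩
      (tailSum p (suc n) ℚ.+ s ℚ.* tailSum p (suc m)) ℚ.+ (ℚ.- s) ℚ.* tailSum p (suc m)
        ≡⟨ cong (ℚ._+ (ℚ.- s) ℚ.* tailSum p (suc m))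
             (trans (tailSum-symmetric pal (suc n) (suc m)
               (cong suc (trans (ℕₚ.+-suc n m) (cong suc n+m≡d)))) p₁≡0) ⟩
      0ℚ ℚ.+ (ℚ.- s) ℚ.* tailSum p (suc m)
        ≡⟨ ℚₚ.+-identityˡ _ ⟩
      (ℚ.- s) ℚ.* tailSum p (suc m) ∎
  ; vanishing = λ n d<n → tailSum-zero p (suc n) λ k n<k →
      vanishing pal k (ℕₚ.≤-<-trans d<n n<k)
  }

-- The tail symmetry between `suc d` and 0, where the first tail is empty, reads -p(1) = p(1). This
-- makes the second division by x - 1 exact without any derivative.
antipalindromic-eval : ∀ {d p} → Palindromic (ℚ.- 1ℚ) d p → eval p 1ℚ ≡ 0ℚ
antipalindromic-eval {d} {p} pal = begin
  t
    ≡⟨ solve 1 (λ x → x := con ½ :* (x :- con (ℚ.- 1ℚ) :* x)) refl t ⟩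
  ½ ℚ.* (t ℚ.- (ℚ.- 1ℚ) ℚ.* t)
    ≡⟨ cong (λ x → ½ ℚ.* (x ℚ.- (ℚ.- 1ℚ) ℚ.* t))
         (tailSum-symmetric pal (suc d) 0 (ℕₚ.+-identityʳ (suc d))) ⟨
  ½ ℚ.* ((tailSum p (suc d) ℚ.+ (ℚ.- 1ℚ) ℚ.* t) ℚ.- (ℚ.- 1ℚ) ℚ.* t)
    ≡⟨ cong (λ x → ½ ℚ.* ((x ℚ.+ (ℚ.- 1ℚ) ℚ.* t) ℚ.- (ℚ.- 1ℚ) ℚ.* t))
         (tailSum-zero p (suc d) (vanishing pal)) ⟩
  ½ ℚ.* ((0ℚ ℚ.+ (ℚ.- 1ℚ) ℚ.* t) ℚ.- (ℚ.- 1ℚ) ℚ.* t)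
    ≡⟨ solve 1 (λ x → con ½ :* ((con 0ℚ :+ x) :- x) := con 0ℚ) refl ((ℚ.- 1ℚ) ℚ.* t) ⟩
  0ℚ ∎
  where
  t : ℚ
  t = eval p 1ℚ

-- Reversal exchanges x^d and 1, whence the symmetry of x^d + 1.
coeff-Xᵈ : ∀ d n m → n + m ≡ d → coeff (X ^ₚ d) n ≡ coeff 1ₚ m
coeff-Xᵈ zero    zero    zero refl = refl
coeff-Xᵈ (suc d) zero    .(suc d) refl = X-⊗ (X ^ₚ d) 0
coeff-Xᵈ (suc d) (suc n) m eq =
  trans (X-⊗ (X ^ₚ d) (suc n)) (coeff-Xᵈ d n m (ℕₚ.suc-injective eq))

coeff-Xᵈ-vanishing : ∀ d n → d < n → coeff (X ^ₚ d) n ≡ 0ℚ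
coeff-Xᵈ-vanishing zero    (suc n) _ = refl
coeff-Xᵈ-vanishing (suc d) (suc n) (s<s d<n) =
  trans (X-⊗ (X ^ₚ d) (suc n)) (coeff-Xᵈ-vanishing d n d<n)

eval-Xᵈ : ∀ d → eval (X ^ₚ d) 1ℚ ≡ 1ℚ
eval-Xᵈ zero    = refl
eval-Xᵈ (suc d) = trans (eval-cong (X ^ₚ suc d) (0ℚ ∷ X ^ₚ d) 1ℚ (X-⊗ (X ^ₚ d)))
  (cong (λ x → 0ℚ ℚ.+ 1ℚ ℚ.* x) (eval-Xᵈ d))

Xᵈ⊕1-palindromic : ∀ d → Palindromic 1ℚ (suc d) (X ^ₚ suc d ⊕ 1ₚ)
Xᵈ⊕1-palindromic d = record
  { symmetric = λ n m eq → begin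
      coeff (X ^ₚ suc d ⊕ 1ₚ) n
        ≡⟨ coeff-⊕ (X ^ₚ suc d) 1ₚ n ⟩
      coeff (X ^ₚ suc d) n ℚ.+ coeff 1ₚ n
        ≡⟨ cong₂ ℚ._+_ (coeff-Xᵈ (suc d) n m eq)
             (sym (coeff-Xᵈ (suc d) m n (trans (ℕₚ.+-comm m n) eq))) ⟩
      coeff 1ₚ m ℚ.+ coeff (X ^ₚ suc d) m
        ≡⟨ solve 2 (λ x y → x :+ y := con 1ℚ :* (y :+ x)) refl
             (coeff 1ₚ m) (coeff (X ^ₚ suc d) m) ⟩
      1ℚ ℚ.* (coeff (X ^ₚ suc d) m ℚ.+ coeff 1ₚ m)
        ≡⟨ cong (1ℚ ℚ.*_) (coeff-⊕ (X ^ₚ suc d) 1ₚ m) ⟨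
      1ℚ ℚ.* coeff (X ^ₚ suc d ⊕ 1ₚ) m ∎
  ; vanishing = λ { (suc n) d<n → trans (coeff-⊕ (X ^ₚ suc d) 1ₚ (suc n))
      (cong (ℚ._+ 0ℚ) (coeff-Xᵈ-vanishing (suc d) (suc n) d<n)) }
  }

numerator-palindromic : ∀ {d p} → Palindromic 1ℚ (suc d) p →
  Palindromic 1ℚ (suc d) (numerator (suc d) p)
numerator-palindromic {d} {p} pal = record
  { symmetric = λ n m eq → begin
      coeff (numerator (suc d) p) n
        ≡⟨ coeff-numerator (suc d) p n ⟩
      t ℚ.* g n ℚ.+ (ℚ.- 2ℚ) ℚ.* coeff p n
        ≡⟨ cong₂ (λ x y → t ℚ.* x ℚ.+ (ℚ.- 2ℚ) ℚ.* y)
             (symmetric (Xᵈ⊕1-palindromic d) n m eq) (symmetric pal n m eq) ⟩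
      t ℚ.* (1ℚ ℚ.* g m) ℚ.+ (ℚ.- 2ℚ) ℚ.* (1ℚ ℚ.* coeff p m)
        ≡⟨ solve 5 (λ o t s x y → t :* (o :* x) :+ s :* (o :* y) := o :* (t :* x :+ s :* y))
             refl 1ℚ t (ℚ.- 2ℚ) (g m) (coeff p m) ⟩
      1ℚ ℚ.* (t ℚ.* g m ℚ.+ (ℚ.- 2ℚ) ℚ.* coeff p m)
        ≡⟨ cong (1ℚ ℚ.*_) (coeff-numerator (suc d) p m) ⟨
      1ℚ ℚ.* coeff (numerator (suc d) p) m ∎
  ; vanishing = λ n d<n → begin
      coeff (numerator (suc d) p) n
        ≡⟨ coeff-numerator (suc d) p n ⟩
      t ℚ.* g n ℚ.+ (ℚ.- 2ℚ) ℚ.* coeff p n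
        ≡⟨ cong₂ (λ x y → t ℚ.* x ℚ.+ (ℚ.- 2ℚ) ℚ.* y)
             (vanishing (Xᵈ⊕1-palindromic d) n d<n) (vanishing pal n d<n) ⟩
      t ℚ.* 0ℚ ℚ.+ (ℚ.- 2ℚ) ℚ.* 0ℚ
        ≡⟨ cong (ℚ._+ 0ℚ) (ℚₚ.*-zeroʳ t) ⟩
      0ℚ ∎
  }
  where
  t : ℚ
  t = eval p 1ℚ
  g : ℕ → ℚ
  g = coeff (X ^ₚ suc d ⊕ 1ₚ)

numerator-eval : ∀ d p → eval (numerator d p) 1ℚ ≡ 0ℚ
numerator-eval d p = begin
  eval (numerator d p) 1ℚ
    ≡⟨ eval-⊕-· (t · (X ^ₚ d ⊕ 1ₚ)) (ℚ.- 2ℚ) p 1ℚ ⟩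
  eval (t · (X ^ₚ d ⊕ 1ₚ)) 1ℚ ℚ.+ (ℚ.- 2ℚ) ℚ.* t
    ≡⟨ cong (ℚ._+ (ℚ.- 2ℚ) ℚ.* t) (begin
         eval (t · (X ^ₚ d ⊕ 1ₚ)) 1ℚ   ≡⟨ eval-· t (X ^ₚ d ⊕ 1ₚ) 1ℚ ⟩
         t ℚ.* eval (X ^ₚ d ⊕ 1ₚ) 1ℚ   ≡⟨ cong (t ℚ.*_) (eval-⊕ (X ^ₚ d) 1ₚ 1ℚ) ⟩
         t ℚ.* (eval (X ^ₚ d) 1ℚ ℚ.+ 1ℚ) ≡⟨ cong (λ x → t ℚ.* (x ℚ.+ 1ℚ)) (eval-Xᵈ d) ⟩
         t ℚ.* 2ℚ                       ∎) ⟩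
  t ℚ.* 2ℚ ℚ.+ (ℚ.- 2ℚ) ℚ.* t
    ≡⟨ solve 2 (λ t s → t :* s :+ (:- s) :* t := con 0ℚ) refl t 2ℚ ⟩
  0ℚ ∎
  where
  t : ℚ
  t = eval p 1ℚ

Nᵈ-palindromic : ∀ {d p} → Palindromic 1ℚ (suc (suc d)) p →
  Palindromic 1ℚ d (Nᵈ (suc (suc d)) p)
-- The two sign changes cancel by computation, and each division lowers the index by one.
Nᵈ-palindromic {d} {p} pal = /[x-1]-palindromic quotient (antipalindromic-eval quotient)
  where
  quotient : Palindromic (ℚ.- 1ℚ) (suc d) (numerator (suc (suc d)) p /[x-1])
  quotient = /[x-1]-palindromic (numerator-palindromic pal) (numerator-eval (suc (suc d)) p)

-- Index of a palindromic polynomial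

DegreeSpec ValuationSpec : Poly → Maybe ℕ → Set
DegreeSpec p nothing  = p ≈ []
DegreeSpec p (just n) = coeff p n ≢ 0ℚ × (∀ k → n < k → coeff p k ≡ 0ℚ)
ValuationSpec p nothing  = p ≈ []
ValuationSpec p (just v) = coeff p v ≢ 0ℚ × (∀ k → k < v → coeff p k ≡ 0ℚ)

degree-spec : ∀ p → DegreeSpec p (degree p)
degree-spec []      n = refl
degree-spec (c ∷ p) with degree p | degree-spec p
... | just n  | nonzero , zeros = nonzero , λ { (suc k) (s<s n<k) → zeros k n<k }
... | nothing | zeros with c ℚₚ.≟ 0ℚ
...   | yes refl = 0∷-zero zeros
...   | no c≢0   = c≢0 , λ { (suc k) _ → zeros k }

valuation-spec : ∀ p → ValuationSpec p (valuation p)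
valuation-spec []      n = refl
valuation-spec (c ∷ p) with c ℚₚ.≟ 0ℚ
... | no c≢0   = c≢0 , λ k ()
... | yes refl with valuation p | valuation-spec p
...   | just v  | nonzero , zeros = nonzero , λ { zero _ → refl ; (suc k) (s<s k<v) → zeros k k<v }
...   | nothing | zeros           = 0∷-zero zeros

-- The mirror image of the leading coefficient is nonzero at `d ∸ n`, so the valuation is at most
-- that. The mirror image of the lowest one is nonzero at `d ∸ v`, so the degree is at least that.
-- Together n + v = d.
palindromic-index : ∀ {d p} → Palindromic 1ℚ d p →
  (index p ≡ nothing × p ≈ []) ⊎ index p ≡ just d
palindromic-index {d} {p} pal
  with degree p | degree-spec p | valuation p | valuation-spec p
... | nothing | p≈0 | _       | _   = inj₁ (refl , p≈0)
... | just _  | _   | nothing | p≈0 = inj₁ (refl , p≈0)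
... | just n  | n-nonzero , above | just v | v-nonzero , below =
  inj₂ (cong just (ℕₚ.≤-antisym n+v≤d d≤n+v))
  where
  bounded : ∀ {k} → coeff p k ≢ 0ℚ → k ≤ d
  bounded {k} k-nonzero = ℕₚ.≮⇒≥ (k-nonzero ∘ vanishing pal k)

  mirror-nonzero : ∀ {k} → coeff p k ≢ 0ℚ → coeff p (d ∸ k) ≢ 0ℚ
  mirror-nonzero {k} k-nonzero eq = k-nonzero
    (trans (symmetric pal k (d ∸ k) (ℕₚ.m+[n∸m]≡n (bounded k-nonzero)))
      (cong (1ℚ ℚ.*_) eq))

  n+v≤d : n + v ≤ d
  n+v≤d = ℕₚ.≤-trans
    (ℕₚ.+-monoʳ-≤ n (ℕₚ.≮⇒≥ (mirror-nonzero n-nonzero ∘ below (d ∸ n))))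
    (ℕₚ.≤-reflexive (ℕₚ.m+[n∸m]≡n (bounded n-nonzero)))

  d≤n+v : d ≤ n + v
  d≤n+v = ℕₚ.≤-trans
    (ℕₚ.≤-reflexive (sym (ℕₚ.m∸n+n≡m (bounded v-nonzero))))
    (ℕₚ.+-monoˡ-≤ v (ℕₚ.≮⇒≥ (mirror-nonzero v-nonzero ∘ above (d ∸ v))))

N₀-just : ∀ p {d} → index p ≡ just d → N₀ p ≡ Nᵈ d p
N₀-just p eq with just d ← index p | refl ← eq = refl

N₀-nothing : ∀ p → index p ≡ nothing → N₀ p ≡ []
N₀-nothing p eq with nothing ← index p = refl

[]-palindromic : ∀ d → Palindromic 1ℚ d []
[]-palindromic d = record { symmetric = λ _ _ _ → refl ; vanishing = λ _ _ → refl }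

iterate-N₀ : ∀ d p → Palindromic 1ℚ d p → constantTerm (iterate N₀ p ⌊ d /2⌋) ≡ ρᵈ d p
iterate-N₀ zero          p pal = refl
iterate-N₀ (suc zero)    p pal = refl
iterate-N₀ (suc (suc d)) p pal with palindromic-index pal
... | inj₂ eq rewrite N₀-just p eq = iterate-N₀ d (Nᵈ (suc (suc d)) p) (Nᵈ-palindromic pal)
-- If the iteration meets a zero polynomial, it continues with `[]`, which is palindromic of every
-- index.
... | inj₁ (eq , p≈0) rewrite N₀-nothing p eq = begin
  constantTerm (iterate N₀ [] ⌊ d /2⌋) ≡⟨ iterate-N₀ d [] ([]-palindromic d) ⟩
  ρᵈ d []                              ≡⟨ ρᵈ-zero d [] (λ _ → refl) ⟩
  0ℚ                                   ≡⟨ ρᵈ-zero (suc (suc d)) p p≈0 ⟨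
  ρᵈ (suc (suc d)) p                   ∎

-- Transfers linearity to `ρ`. The default value 0 of `ρ` at the zero polynomial is the one that
-- linearity dictates.
ρ≡ρᵈ : ∀ {d p} → Palindromic 1ℚ d p → ρ p ≡ ρᵈ d p
ρ≡ρᵈ {d} {p} pal with index p | palindromic-index pal
... | nothing | inj₁ (_ , p≈0) = sym (ρᵈ-zero d p p≈0)
... | just _  | inj₂ refl      = iterate-N₀ d p pal

palindromic-cong : ∀ {s d p q} → p ≈ q → Palindromic s d q → Palindromic s d p
palindromic-cong {s} p≈q pal = record
  { symmetric = λ n m eq → trans (p≈q n)
      (trans (symmetric pal n m eq) (cong (s ℚ.*_) (sym (p≈q m))))
  ; vanishing = λ n d<n → trans (p≈q n) (vanishing pal n d<n)
  }

ρ-cong : ∀ {d} p q → Palindromic 1ℚ d q → p ≈ q → ρ p ≡ ρ q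
ρ-cong {d} p q pal p≈q = begin
  ρ p    ≡⟨ ρ≡ρᵈ (palindromic-cong p≈q pal) ⟩
  ρᵈ d p ≡⟨ ρᵈ-cong d p q p≈q ⟩
  ρᵈ d q ≡⟨ ρ≡ρᵈ pal ⟨
  ρ q    ∎

X-palindromic : ∀ {d p} → Palindromic 1ℚ d p → Palindromic 1ℚ (suc (suc d)) (0ℚ ∷ p)
X-palindromic {d} {p} pal = record
  { symmetric = sym′
  ; vanishing = λ { (suc n) (s<s d<n) → vanishing pal n (ℕₚ.<-trans (ℕₚ.n<1+n d) d<n) }
  }
  where
  sym′ : ∀ n m → n + m ≡ suc (suc d) → coeff (0ℚ ∷ p) n ≡ 1ℚ ℚ.* coeff (0ℚ ∷ p) m
  sym′ zero    .(suc (suc d)) refl = sym (cong (1ℚ ℚ.*_) (vanishing pal (suc d) ℕₚ.≤-refl))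
  sym′ (suc n) zero    eq = vanishing pal n
    (ℕₚ.≤-reflexive (sym (trans (sym (ℕₚ.+-identityʳ n)) (ℕₚ.suc-injective eq))))
  sym′ (suc n) (suc m) eq = symmetric pal n m
    (ℕₚ.suc-injective (trans (sym (ℕₚ.+-suc n m)) (ℕₚ.suc-injective eq)))

1+X-palindromic : ∀ {d p} → Palindromic 1ℚ d p → Palindromic 1ℚ (suc d) (p ⊕ (0ℚ ∷ p))
1+X-palindromic {d} {p} pal = record
  { symmetric = λ n m eq → begin
      coeff (p ⊕ (0ℚ ∷ p)) n
        ≡⟨ coeff-⊕ p (0ℚ ∷ p) n ⟩
      coeff p n ℚ.+ coeff (0ℚ ∷ p) n
        ≡⟨ cong₂ ℚ._+_ (mirror n m eq) (sym (mirror m n (trans (ℕₚ.+-comm m n) eq))) ⟩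
      coeff (0ℚ ∷ p) m ℚ.+ coeff p m
        ≡⟨ solve 2 (λ x y → x :+ y := con 1ℚ :* (y :+ x)) refl (coeff (0ℚ ∷ p) m) (coeff p m) ⟩
      1ℚ ℚ.* (coeff p m ℚ.+ coeff (0ℚ ∷ p) m)
        ≡⟨ cong (1ℚ ℚ.*_) (coeff-⊕ p (0ℚ ∷ p) m) ⟨
      1ℚ ℚ.* coeff (p ⊕ (0ℚ ∷ p)) m ∎
  ; vanishing = λ { (suc n) d<n → trans (coeff-⊕ p (0ℚ ∷ p) (suc n))
      (cong₂ ℚ._+_ (vanishing pal (suc n) (ℕₚ.<-trans (ℕₚ.n<1+n d) d<n))
        (vanishing pal n (s≤s⁻¹ d<n))) }
  }
  where
  mirror : ∀ n m → n + m ≡ suc d → coeff p n ≡ coeff (0ℚ ∷ p) m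
  mirror n zero    eq = vanishing pal n
    (ℕₚ.≤-reflexive (sym (trans (sym (ℕₚ.+-identityʳ n)) eq)))
  mirror n (suc m) eq = trans
    (symmetric pal n m (ℕₚ.suc-injective (trans (sym (ℕₚ.+-suc n m)) eq)))
    (ℚₚ.*-identityˡ (coeff p m))

-- This is 2i + j, by recursion on `i` so that each factor x exposes the two successors that `ρᵈ`
-- matches on.
indexP : ℕ → ℕ → ℕ
indexP zero    j = j
indexP (suc i) j = suc (suc (indexP i j))

indexP-suc : ∀ i j → indexP i (suc j) ≡ suc (indexP i j)
indexP-suc zero    j = refl
indexP-suc (suc i) j = cong (2 +_) (indexP-suc i j)

P-palindromic : ∀ i j → Palindromic 1ℚ (indexP i j) (P i j)
P-palindromic (suc i) j       = palindromic-cong (P-sucˡ i j) (X-palindromic (P-palindromic i j))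
P-palindromic zero    (suc j) = palindromic-cong (P-sucʳ 0 j) (1+X-palindromic (P-palindromic 0 j))
P-palindromic zero    zero    = record
  { symmetric = λ { zero zero _ → refl }
  ; vanishing = λ { (suc n) _ → refl }
  }

-- Multiples of (x - 1)²

[X-1]⊗_ : Poly → Poly
[X-1]⊗ q = (0ℚ ∷ q) ⊕ (ℚ.- 1ℚ) · q

eval-∷-difference : ∀ c q → eval ((c ∷ q) ⊕ (ℚ.- 1ℚ) · q) 1ℚ ≡ c
eval-∷-difference c q = trans (eval-⊕-· (c ∷ q) (ℚ.- 1ℚ) q 1ℚ)
  (solve 2 (λ c x → (c :+ con 1ℚ :* x) :+ con (ℚ.- 1ℚ) :* x := c) refl c (eval q 1ℚ))

-- The dividend is c + (x - 1) q, with remainder `c`. The remainder is left arbitrary because the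
-- recursion meets the head of `q` in its place.
∷-difference-/[x-1] : ∀ c q → ((c ∷ q) ⊕ (ℚ.- 1ℚ) · q) /[x-1] ≈ q
∷-difference-/[x-1] c []      zero    = refl
∷-difference-/[x-1] c []      (suc n) = refl
∷-difference-/[x-1] c (b ∷ q) zero    = eval-∷-difference b q
∷-difference-/[x-1] c (b ∷ q) (suc n) = ∷-difference-/[x-1] b q n

/[x-1]-cong : ∀ p q → p ≈ q → p /[x-1] ≈ q /[x-1]
/[x-1]-cong p q p≈q n = trans (coeffwise (/[x-1]-combination (≈⇒combination p q p≈q)) n)
  (solve 1 (λ x → x :+ con 0ℚ :* x := x) refl (coeff (q /[x-1]) n))

-- The value at 1 is zero, so the numerator is -2 times the polynomial itself, whatever `d` is, and
-- the two divisions undo the square.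
Nᵈ-square : ∀ d q → Nᵈ d ([X-1]⊗ [X-1]⊗ q) ≈ [] +[ ℚ.- 2ℚ ] q
Nᵈ-square d q = combination λ n → begin
  coeff (Nᵈ d z) n
    ≡⟨ coeffwise (/[x-1]-combination (/[x-1]-combination numerator≈)) n ⟩
  0ℚ ℚ.+ (ℚ.- 2ℚ) ℚ.* coeff (z /[x-1] /[x-1]) n
    ≡⟨ cong (λ x → 0ℚ ℚ.+ (ℚ.- 2ℚ) ℚ.* x)
         (trans (/[x-1]-cong (z /[x-1]) ([X-1]⊗ q) (∷-difference-/[x-1] 0ℚ ([X-1]⊗ q)) n)
           (∷-difference-/[x-1] 0ℚ q n)) ⟩
  0ℚ ℚ.+ (ℚ.- 2ℚ) ℚ.* coeff q n ∎
  where
  z : Poly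
  z = [X-1]⊗ [X-1]⊗ q

  numerator≈ : numerator d z ≈ [] +[ ℚ.- 2ℚ ] z
  numerator≈ = combination λ n → begin
    coeff (numerator d z) n
      ≡⟨ coeff-numerator d z n ⟩
    eval z 1ℚ ℚ.* coeff (X ^ₚ d ⊕ 1ₚ) n ℚ.+ (ℚ.- 2ℚ) ℚ.* coeff z n
      ≡⟨ cong (ℚ._+ (ℚ.- 2ℚ) ℚ.* coeff z n)
           (trans (cong (ℚ._* coeff (X ^ₚ d ⊕ 1ₚ) n) (eval-∷-difference 0ℚ ([X-1]⊗ q)))
             (ℚₚ.*-zeroˡ (coeff (X ^ₚ d ⊕ 1ₚ) n))) ⟩
    0ℚ ℚ.+ (ℚ.- 2ℚ) ℚ.* coeff z n ∎

4ℚ : ℚ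
4ℚ = 2ℚ ℚ.* 2ℚ

coeff-[X-1]⊗ : ∀ q n → coeff ([X-1]⊗ q) n ≡ coeff (0ℚ ∷ q) n ℚ.+ (ℚ.- 1ℚ) ℚ.* coeff q n
coeff-[X-1]⊗ q n = trans (coeff-⊕ (0ℚ ∷ q) ((ℚ.- 1ℚ) · q) n)
  (cong (coeff (0ℚ ∷ q) n ℚ.+_) (coeff-· (ℚ.- 1ℚ) q n))

-- (1 + x)² = (x - 1)² + 4x
P-+2 : ∀ i j → P i (suc (suc j)) ≈ [X-1]⊗ [X-1]⊗ P i j +[ 4ℚ ] P (suc i) j
P-+2 i j = combination λ n → let
    x₀ = coeff q n
    x₁ = coeff (0ℚ ∷ q) n
    x₂ = coeff (0ℚ ∷ 0ℚ ∷ q) n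
  in begin
  coeff (P i (suc (suc j))) n
    ≡⟨ P-sucʳ i (suc j) n ⟩
  coeff (P i (suc j) ⊕ (0ℚ ∷ P i (suc j))) n
    ≡⟨ coeff-⊕ (P i (suc j)) (0ℚ ∷ P i (suc j)) n ⟩
  coeff (P i (suc j)) n ℚ.+ coeff (0ℚ ∷ P i (suc j)) n
    ≡⟨ cong₂ ℚ._+_ (P-sucʳ i j n) (∷-cong (P-sucʳ i j) n) ⟩
  coeff (q ⊕ (0ℚ ∷ q)) n ℚ.+ coeff ((0ℚ ∷ q) ⊕ (0ℚ ∷ 0ℚ ∷ q)) n
    ≡⟨ cong₂ ℚ._+_ (coeff-⊕ q (0ℚ ∷ q) n) (coeff-⊕ (0ℚ ∷ q) (0ℚ ∷ 0ℚ ∷ q) n) ⟩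
  (x₀ ℚ.+ x₁) ℚ.+ (x₁ ℚ.+ x₂)
    ≡⟨ solve 3 (λ x₀ x₁ x₂ →
         (x₀ :+ x₁) :+ (x₁ :+ x₂) :=
         ((x₂ :+ con (ℚ.- 1ℚ) :* x₁) :+ con (ℚ.- 1ℚ) :* (x₁ :+ con (ℚ.- 1ℚ) :* x₀))
           :+ con 4ℚ :* x₁)
         refl x₀ x₁ x₂ ⟩
  ((x₂ ℚ.+ (ℚ.- 1ℚ) ℚ.* x₁) ℚ.+ (ℚ.- 1ℚ) ℚ.* (x₁ ℚ.+ (ℚ.- 1ℚ) ℚ.* x₀)) ℚ.+ 4ℚ ℚ.* x₁
    ≡⟨ cong₂ (λ x y → (x ℚ.+ (ℚ.- 1ℚ) ℚ.* y) ℚ.+ 4ℚ ℚ.* x₁)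
         (coeff-[X-1]⊗ (0ℚ ∷ q) n) (coeff-[X-1]⊗ q n) ⟨
  (coeff ([X-1]⊗ (0ℚ ∷ q)) n ℚ.+ (ℚ.- 1ℚ) ℚ.* coeff ([X-1]⊗ q) n) ℚ.+ 4ℚ ℚ.* x₁
    ≡⟨ cong₂ (λ x y → x ℚ.+ 4ℚ ℚ.* y) (coeff-[X-1]⊗ ([X-1]⊗ q) n) (P-sucˡ i j n) ⟨
  coeff ([X-1]⊗ [X-1]⊗ q) n ℚ.+ 4ℚ ℚ.* coeff (P (suc i) j) n ∎
  where
  q : Poly
  q = P i j

-- The multiple of (x - 1)² uses up one application of the operator and falls to index 2i + j, while
-- the term with 4x keeps index 2i + j + 2, that of `P (suc i) j`.
ρ-P-+2 : ∀ i j →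
  ρ (P i (suc (suc j))) ≡ (ℚ.- 2ℚ) ℚ.* ρ (P i j) ℚ.+ 4ℚ ℚ.* ρ (P (suc i) j)
ρ-P-+2 i j = begin
  ρ (P i (suc (suc j)))
    ≡⟨ ρ≡ρᵈ (subst (λ e → Palindromic 1ℚ e (P i (suc (suc j))))
         (trans (indexP-suc i (suc j)) (cong suc (indexP-suc i j)))
         (P-palindromic i (suc (suc j)))) ⟩
  ρᵈ (suc (suc d)) (P i (suc (suc j)))
    ≡⟨ ρᵈ-combination (suc (suc d)) (P-+2 i j) ⟩
  ρᵈ d (Nᵈ (suc (suc d)) z) ℚ.+ 4ℚ ℚ.* ρᵈ (suc (suc d)) (P (suc i) j)
    ≡⟨ cong₂ (λ x y → x ℚ.+ 4ℚ ℚ.* y)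
         (ρᵈ-combination d (Nᵈ-square (suc (suc d)) (P i j)))
         (sym (ρ≡ρᵈ (P-palindromic (suc i) j))) ⟩
  (ρᵈ d [] ℚ.+ (ℚ.- 2ℚ) ℚ.* ρᵈ d (P i j)) ℚ.+ 4ℚ ℚ.* ρ (P (suc i) j)
    ≡⟨ cong₂ (λ x y → (x ℚ.+ (ℚ.- 2ℚ) ℚ.* y) ℚ.+ 4ℚ ℚ.* ρ (P (suc i) j))
         (ρᵈ-zero d [] (λ _ → refl)) (sym (ρ≡ρᵈ (P-palindromic i j))) ⟩
  (0ℚ ℚ.+ (ℚ.- 2ℚ) ℚ.* ρ (P i j)) ℚ.+ 4ℚ ℚ.* ρ (P (suc i) j)
    ≡⟨ cong (ℚ._+ 4ℚ ℚ.* ρ (P (suc i) j)) (ℚₚ.+-identityˡ ((ℚ.- 2ℚ) ℚ.* ρ (P i j))) ⟩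
  (ℚ.- 2ℚ) ℚ.* ρ (P i j) ℚ.+ 4ℚ ℚ.* ρ (P (suc i) j) ∎
  where
  d : ℕ
  d = indexP i j
  z : Poly
  z = [X-1]⊗ [X-1]⊗ P i j

A-P : ∀ i → A i ≡ ρ (P i 0)
A-P i = ρ-cong (X ^ₚ i) (P i 0) (P-palindromic i 0) (Xⁱ-P i)

B-P : ∀ i → B i ≡ ρ (P i 1)
B-P i = ρ-cong (1+X ⊗ X ^ₚ i) (P i 1) (P-palindromic i 1) (1+X-Xⁱ-P i)

-- The entries of the two matrices

entry : Columns
entry j i = ρ (P i j) ℚ.* ½ ^ ⌊ j /2⌋

-- Two more columns bring one more factor 1/2, which halves the coefficients 4 and -2.
entry-+2 : ∀ j i → entry (suc (suc j)) i ≡ 2ℚ ℚ.* entry j (suc i) ℚ.+ (ℚ.- 1ℚ) ℚ.* entry j i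
entry-+2 j i = trans (cong (ℚ._* (½ ℚ.* ½ ^ ⌊ j /2⌋)) (ρ-P-+2 i j))
  (solve 3 (λ x y h →
     (con (ℚ.- 2ℚ) :* x :+ con 4ℚ :* y) :* (con ½ :* h) :=
     con 2ℚ :* (y :* h) :+ con (ℚ.- 1ℚ) :* (x :* h))
   refl (ρ (P i j)) (ρ (P (suc i) j)) (½ ^ ⌊ j /2⌋))

hankel : Columns
hankel j i = a (2 * i + j)

hankel-suc : ∀ j i → hankel j (suc i) ≡ hankel (suc (suc j)) i
hankel-suc j i = cong a (begin
  2 * suc i + j         ≡⟨ cong (_+ j) (ℕₚ.*-suc 2 i) ⟩
  suc (suc (2 * i + j)) ≡⟨ cong suc (ℕₚ.+-suc (2 * i) j) ⟨
  suc (2 * i + suc j)   ≡⟨ ℕₚ.+-suc (2 * i) (suc j) ⟨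
  2 * i + suc (suc j)   ∎)

interleave-shift : ∀ f g i j →
  interleave f g (2 * i + j) ≡ interleave (f ∘ (i +_)) (g ∘ (i +_)) j
interleave-shift f g zero    j = refl
interleave-shift f g (suc i) j = trans
  (cong (λ k → interleave f g (k + j)) (ℕₚ.*-suc 2 i))
  (interleave-shift (f ∘ suc) (g ∘ suc) i j)

hankel-0 : ∀ i → hankel 0 i ≡ ρ (P i 0)
hankel-0 i = begin
  hankel 0 i ≡⟨ interleave-shift A B i 0 ⟩
  A (i + 0)  ≡⟨ cong A (ℕₚ.+-identityʳ i) ⟩
  A i        ≡⟨ A-P i ⟩
  ρ (P i 0)  ∎

hankel-1 : ∀ i → hankel 1 i ≡ ρ (P i 1)
hankel-1 i = begin
  hankel 1 i ≡⟨ interleave-shift A B i 1 ⟩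
  B (i + 0)  ≡⟨ cong B (ℕₚ.+-identityʳ i) ⟩
  B i        ≡⟨ B-P i ⟩
  ρ (P i 1)  ∎

entry-leading : ∀ j → Leading hankel (2ℚ ^ ⌊ j /2⌋) j (entry j)
entry-leading zero = leading (zero λ _ → refl) λ i →
  trans (cong (ℚ._* 1ℚ) (sym (hankel-0 i)))
    (solve 1 (λ x → x :* con 1ℚ := con 0ℚ :+ con 1ℚ :* x) refl (hankel 0 i))
entry-leading (suc zero) = leading (zero λ _ → refl) λ i →
  trans (cong (ℚ._* 1ℚ) (sym (hankel-1 i)))
    (solve 1 (λ x → x :* con 1ℚ := con 0ℚ :+ con 1ℚ :* x) refl (hankel 1 i))
entry-leading (suc (suc j)) with leading {r} r-span split ← entry-leading j = leading
  -- The remainder of column `j`, read one row down, involves columns below `j + 2`, and so does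
  -- `entry j` itself. The shifted leading term is 2 · 2^⌊j/2⌋ times column `j + 2`.
  (span-+ (span-scale 2ℚ (span-shift hankel-suc r-span)) (span-scale (ℚ.- 1ℚ) entry-span))
  λ i → begin
    entry (suc (suc j)) i
      ≡⟨ entry-+2 j i ⟩
    2ℚ ℚ.* entry j (suc i) ℚ.+ (ℚ.- 1ℚ) ℚ.* entry j i
      ≡⟨ cong (λ x → 2ℚ ℚ.* x ℚ.+ (ℚ.- 1ℚ) ℚ.* entry j i) (split (suc i)) ⟩
    2ℚ ℚ.* (r (suc i) ℚ.+ 2ℚ ^ ⌊ j /2⌋ ℚ.* hankel j (suc i)) ℚ.+ (ℚ.- 1ℚ) ℚ.* entry j i
      ≡⟨ cong (λ x → 2ℚ ℚ.* (r (suc i) ℚ.+ 2ℚ ^ ⌊ j /2⌋ ℚ.* x) ℚ.+ (ℚ.- 1ℚ) ℚ.* entry j i)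
           (hankel-suc j i) ⟩
    2ℚ ℚ.* (r (suc i) ℚ.+ 2ℚ ^ ⌊ j /2⌋ ℚ.* hankel (suc (suc j)) i) ℚ.+ (ℚ.- 1ℚ) ℚ.* entry j i
      ≡⟨ solve 5 (λ t x d h y → t :* (x :+ d :* h) :+ y := (t :* x :+ y) :+ t :* d :* h)
           refl 2ℚ (r (suc i)) (2ℚ ^ ⌊ j /2⌋) (hankel (suc (suc j)) i)
           ((ℚ.- 1ℚ) ℚ.* entry j i) ⟩
    (2ℚ ℚ.* r (suc i) ℚ.+ (ℚ.- 1ℚ) ℚ.* entry j i) ℚ.+
      2ℚ ^ ⌊ suc (suc j) /2⌋ ℚ.* hankel (suc (suc j)) i ∎
  where
  entry-span : Span hankel (suc (suc j)) (entry j)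
  entry-span with leading r-span split ← entry-leading j =
    add (2ℚ ^ ⌊ j /2⌋) j (ℕₚ.m≤n⇒m≤1+n ℕₚ.≤-refl)
      (span-weaken (ℕₚ.m≤n+m j 2) r-span) split

theorem26p3 : ∀ (N : ℕ) → 1 ≤ N →
    det (M N) ≡ 2ℚ ^ τ N ℚ.* det {N} (λ i j → a (2 * toℕ i + toℕ j))
theorem26p3 N _ = begin
  -- Both determinants of the statement are of the form `D N` by computation.
  D N entry
    ≡⟨ D-triangular N (λ j → 2ℚ ^ ⌊ j /2⌋) hankel entry entry-leading ⟩
  prod N (λ j → 2ℚ ^ ⌊ j /2⌋) ℚ.* D N hankel
    ≡⟨ cong (ℚ._* D N hankel) (prod-τ N) ⟩
  2ℚ ^ τ N ℚ.* D N hankel ∎
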